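{- Let $H$ be a $3$-hypergraph, and suppose that for every forest $F$ on the vertex set $V(H)$ a root is fixed in each component of $F$. Then there exist a $3$-hypergraph $\tilde H$ related to $H$ and an acyclic quasigraph $\sigma$ in $\tilde H$ such that $\sigma$ has no bad leaves (with respect to the roots fixed for the forest $\sigma^*$) and $V(\tilde H)$ admits a $\sigma$-skeletal partition $\mathcal S$ (with respect to $\tilde H$).
   Context: A $3$-hypergraph is a finite hypergraph (multiple hyperedges allowed) all of whose hyperedges have size $2$ or $3$. A quasigraph $\pi$ in $H$ assigns to each hyperedge $e$ either a $2$-subset of $e$ or $\emptyset$; $e$ is used if $\pi(e)\ne\emptyset$. $\pi^*$ is the graph on $V(H)$ whose edges are the pairs $\pi(e)$, $e$ used; $\pi$ is acyclic if $\pi^*$ is a forest; $\pi$ is a quasicycle if $\pi^*$ is a cycle plus isolated vertices; a $3$-hypergraph is acyclic if it admits no quasicycle. For a partition $\mathcal P$ of $V(H)$, a hyperedge (or pair) is $\mathcal P$-crossing if it meets at least two classes, and $e/\mathcal P$ is the set of classes met by $e$; $H/\mathcal P$ is the $3$-hypergraph on vertex set $\mathcal P$ with one hyperedge $e/\mathcal P$ per $\mathcal P$-crossing hyperedge $e$; $\pi/\mathcal P$ is the quasigraph in $H/\mathcal P$ with value $\pi(e)/\mathcal P$ on $e/\mathcal P$ if $\pi(e)$ is $\mathcal P$-crossing and $\emptyset$ otherwise; $\overline{\pi/\mathcal P}$ is the subhypergraph of $H/\mathcal P$ of hyperedges unused by $\pi/\mathcal P$. $\pi$ is connected on $X\subseteq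 V(H)$ if $\pi^*[X]$ is connected, and anticonnected on $X$ if for every partition $\mathcal R$ of $X$ with at least two classes some hyperedge $f$ meets at least two classes of $\mathcal R$ while $\pi(f)$ lies in one class (possibly $\pi(f)=\emptyset$). A partition $\mathcal P$ of $V(H)$ is $\pi$-skeletal if $\pi$ is connected and anticonnected on each class of $\mathcal P$ and $\overline{\pi/\mathcal P}$ is acyclic. Bad leaves and switches: for acyclic $\pi$, orient each edge of $\pi^*$ towards the root of its component; a used hyperedge $e$ is associated with $u$ if $u$ is the tail of $\pi(e)$. A vertex $u$ is a bad leaf for $\pi$ if $u$ is a leaf of $\pi^*$, $u$ is incident with exactly three hyperedges, exactly one of which, $e$, has size $3$, and $e$ is associated with $u$; then the hyperedges at $u$ are $ua,ub,ucd$ with $\pi(ucd)=\{u,c\}$. The switch at $u$ replaces $ua,ub,ucd$ by $uab,uc,ud$, producing $H^{(u)}$ and the quasigraph $\pi^{(u)}$ with value $\{u,c\}$ on $uc$, unused $ud,uab$, and equal to $\pi$ elsewhere. A hypergraph is related to $H$ if it can be obtained from $H$ by a finite sequence of switch operations (each at a bad leaf of some acyclic quasigraph in the current hypergraph). -}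

module Defs where

open import Data.Nat using (ℕ; zero; suc; _≤ᵇ_; _≤_)
open import Data.Fin using (Fin; zero; suc; inject₁; fromℕ; _≟_)
open import Data.Fin.Subset using (Subset; ∣_∣; _∈_; _⊆_; ⁅_⁆; _∪_; _─_)
open import Data.Bool using (Bool; true; false; _∧_; not; if_then_else_)
open import Data.Maybe using (Maybe; just; nothing)
open import Data.Vec using (Vec; []; _∷_; lookup; tabulate; _[_]≔_; fromList)
open import Data.List using (List; []; _∷_; length; allFin)
open import Data.Bool.ListAction using (any)
open import Data.Product using (Σ; ∃; _×_; _,_)
open import Data.Sum using (_⊎_)
open import Relation.Nullary using (¬_)
open import Relation.Nullary.Decidable using (⌊_⌋)
open import Relation.Binary.PropositionalEquality using (_≡_; _≢_)
open import Relation.Binary.Construct.Closure.ReflexiveTransitive using (Star)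
open import Function using (_∘_)
open import Function.Definitions using (Injective)

-- Hypergraphs on the vertex set Fin n with m hyperedges (indexed by Fin m;
-- multiple hyperedges allowed).  A hyperedge is a subset of the vertices.

Hyp : ℕ → ℕ → Set
Hyp n m = Vec (Subset n) m

Is3Hyp : ∀ {n m} → Hyp n m → Set
Is3Hyp {m = m} H = (i : Fin m) → ∣ lookup H i ∣ ≡ 2 ⊎ ∣ lookup H i ∣ ≡ 3

-- A quasigraph: to each hyperedge a 2-subset of it, or nothing (= ∅, unused).
Quasi : ℕ → ℕ → Set
Quasi n m = Fin m → Maybe (Subset n)

ValidQ : ∀ {n m} → Hyp n m → Quasi n m → Set
ValidQ {n} {m} H π = (i : Fin m) (p : Subset n) → π i ≡ just p →
  (∣ p ∣ ≡ 2) × (p ⊆ lookup H i)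

-- The multigraph π* : one edge π(i) for every used hyperedge i.

Joins : ∀ {n m} → Quasi n m → Fin m → Fin n → Fin n → Set
Joins {n} π i u v = Σ (Subset n) λ p → (π i ≡ just p) × (u ∈ p) × (v ∈ p) × (u ≢ v)

record Cycle {n m} (π : Quasi n m) : Set where
  field
    L     : ℕ
    L≥1   : 1 ≤ L
    vs    : Fin (suc L) → Fin n
    es    : Fin (suc L) → Fin m
    vsInj : Injective _≡_ _≡_ vs
    esInj : Injective _≡_ _≡_ es
    step  : (i : Fin L) → Joins π (es (inject₁ i)) (vs (inject₁ i)) (vs (suc i))
    close : Joins π (es (fromℕ L)) (vs (fromℕ L)) (vs zero)

AcyclicQ : ∀ {n m} → Quasi n m → Set
AcyclicQ π = ¬ Cycle π

IsQuasicycle : ∀ {n m} → Quasi n m → Set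
IsQuasicycle {n} {m} π = Σ (Cycle π) λ C →
  (i : Fin m) (p : Subset n) → π i ≡ just p → ∃ λ j → Cycle.es C j ≡ i

AcyclicHyp : ∀ {n m} → Hyp n m → Set
AcyclicHyp {n} {m} H = (π : Quasi n m) → ValidQ H π → ¬ IsQuasicycle π

data ReachIn {n m} (π : Quasi n m) (X : Fin n → Set) : Fin n → Fin n → Set where
  hereIn : ∀ {u} → X u → ReachIn π X u u
  stepIn : ∀ {u w v} (i : Fin m) → X u → Joins π i u w → ReachIn π X w v →
         ReachIn π X u v

ConnectedOn : ∀ {n m} → Quasi n m → (Fin n → Set) → Set
ConnectedOn {n} π X = (u v : Fin n) → X u → X v → ReachIn π X u v

-- a partition R of X is encoded by a labelling c : Fin n → Fin n
-- (classes = nonempty fibres of c restricted to X)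
AnticonnectedOn : ∀ {n m} → Hyp n m → Quasi n m → (Fin n → Set) → Set
AnticonnectedOn {n} {m} H π X =
  (c : Fin n → Fin n) →
  (Σ (Fin n) λ u → Σ (Fin n) λ v → X u × X v × c u ≢ c v) →
  Σ (Fin m) λ f →
    (Σ (Fin n) λ x → Σ (Fin n) λ y →
       (x ∈ lookup H f) × (y ∈ lookup H f) × X x × X y × c x ≢ c y)
    × (π f ≡ nothing ⊎
       Σ (Subset n) λ p → (π f ≡ just p) ×
         Σ (Fin n) λ k → (x : Fin n) → x ∈ p → X x × c x ≡ k)

-- Quotients by a partition P of V(H), encoded by a labelling P : Fin n → Fin n.
-- H/P is realised on the vertex set Fin n of labels (labels not used by P
-- are isolated vertices, which do not affect acyclicity).

imageS : ∀ {n} → (Fin n → Fin n) → Subset n → Subset n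
imageS {n} P e = tabulate λ j → any (λ x → lookup e x ∧ ⌊ P x ≟ j ⌋) (allFin n)

crossingᵇ : ∀ {n} → (Fin n → Fin n) → Subset n → Bool
crossingᵇ P e = 2 ≤ᵇ ∣ imageS P e ∣

usedCrossingᵇ : ∀ {n} → (Fin n → Fin n) → Maybe (Subset n) → Bool
usedCrossingᵇ P nothing  = false
usedCrossingᵇ P (just p) = crossingᵇ P p

-- the hyperedges e/P of H/P that are unused by π/P  (the hypergraph
-- \overline{π/P}): e is P-crossing and π(e) is not P-crossing
unusedQuotL : ∀ {n m} → (Fin n → Fin n) → Hyp n m → Quasi n m → List (Subset n)
unusedQuotL P [] π = []
unusedQuotL P (e ∷ H) π =
  if crossingᵇ P e ∧ not (usedCrossingᵇ P (π zero))
  then imageS P e ∷ unusedQuotL P H (π ∘ suc)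
  else unusedQuotL P H (π ∘ suc)

UnusedQuot : ∀ {n m} (P : Fin n → Fin n) (H : Hyp n m) (π : Quasi n m) →
  Hyp n (length (unusedQuotL P H π))
UnusedQuot P H π = fromList (unusedQuotL P H π)

Skeletal : ∀ {n m} → Hyp n m → Quasi n m → (Fin n → Fin n) → Set
Skeletal {n} H π P =
  ((j : Fin n) → ConnectedOn π (λ v → P v ≡ j) × AnticonnectedOn H π (λ v → P v ≡ j))
  × AcyclicHyp (UnusedQuot P H π)

Adj : ℕ → Set
Adj n = Vec (Vec Bool n) n

Edge : ∀ {n} → Adj n → Fin n → Fin n → Set
Edge A u v = lookup (lookup A u) v ≡ true

data ReachA {n} (A : Adj n) : Fin n → Fin n → Set where
  hereA : ∀ {u} → ReachA A u u
  stepA : ∀ {u w v} → Edge A u w → ReachA A w v → ReachA A u v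

record CycleA {n} (A : Adj n) : Set where
  field
    LA     : ℕ
    LA≥2   : 2 ≤ LA
    vsA    : Fin (suc LA) → Fin n
    vsAInj : Injective _≡_ _≡_ vsA
    stepA' : (i : Fin LA) → Edge A (vsA (inject₁ i)) (vsA (suc i))
    closeA : Edge A (vsA (fromℕ LA)) (vsA zero)

ForestA : ∀ {n} → Adj n → Set
ForestA {n} A = ((u v : Fin n) → Edge A u v → Edge A v u)
  × ((u : Fin n) → ¬ Edge A u u) × ¬ CycleA A

record RootChoice (n : ℕ) : Set where
  field
    root   : Adj n → Fin n → Fin n
    inComp : (A : Adj n) → ForestA A → (v : Fin n) → ReachA A v (root A v)
    const  : (A : Adj n) → ForestA A → (u v : Fin n) → ReachA A u v →
             root A u ≡ root A v
open RootChoice public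

joinsᵇ : ∀ {n} → Maybe (Subset n) → Fin n → Fin n → Bool
joinsᵇ nothing  u v = false
joinsᵇ (just p) u v = lookup p u ∧ lookup p v ∧ not ⌊ u ≟ v ⌋

adjQ : ∀ {n m} → Quasi n m → Adj n
adjQ {n} {m} π = tabulate λ u → tabulate λ v → any (λ i → joinsᵇ (π i) u v) (allFin m)

data ReachAvoid {n m} (π : Quasi n m) (i : Fin m) : Fin n → Fin n → Set where
  hereAv : ∀ {u} → ReachAvoid π i u u
  stepAv : ∀ {u w v} (j : Fin m) → j ≢ i → Joins π j u w → ReachAvoid π i w v →
         ReachAvoid π i u v

-- u is the tail of π(i) when the edges of π* are oriented towards the
-- root of their component: the other end of π(i) reaches the root of u
-- without using the edge π(i)
Tail : ∀ {n m} → RootChoice n → Quasi n m → Fin m → Fin n → Set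
Tail {n} R π i u =
  Σ (Fin n) λ v → Joins π i u v × ReachAvoid π i v (root R (adjQ π) u)

record BadLeaf {n m} (R : RootChoice n) (H : Hyp n m) (π : Quasi n m) (u : Fin n) : Set where
  field
    ia ib ie : Fin m
    ia≢ib    : ia ≢ ib
    ia≢ie    : ia ≢ ie
    ib≢ie    : ib ≢ ie
    sa       : ∣ lookup H ia ∣ ≡ 2
    sb       : ∣ lookup H ib ∣ ≡ 2
    se       : ∣ lookup H ie ∣ ≡ 3
    ua       : u ∈ lookup H ia
    ub       : u ∈ lookup H ib
    ue       : u ∈ lookup H ie
    only3    : (j : Fin m) → u ∈ lookup H j → j ≡ ia ⊎ j ≡ ib ⊎ j ≡ ie
    leaf     : (j : Fin m) (p : Subset n) → π j ≡ just p → u ∈ p → j ≡ ie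
    assoc    : Tail R π ie u
open BadLeaf public

-- Switches and related hypergraphs.
-- At a bad leaf u with hyperedges ua (slot ia), ub (slot ib), ucd (slot ie)
-- and π(ucd) = uc = p, the switch puts uab in slot ia, ud in slot ib, uc in slot ie.

switch : ∀ {n m} → Hyp n m → (ia ib ie : Fin m) → Fin n → Subset n → Hyp n m
switch H ia ib ie u p =
  ((H [ ia ]≔ (lookup H ia ∪ lookup H ib))
      [ ib ]≔ ((lookup H ie ─ p) ∪ ⁅ u ⁆))
      [ ie ]≔ p

SwitchStep : ∀ {n m} → RootChoice n → Hyp n m → Hyp n m → Set
SwitchStep {n} {m} R H H' =
  Σ (Quasi n m) λ π → ValidQ H π × AcyclicQ π ×
  Σ (Fin n) λ u → Σ (BadLeaf R H π u) λ b →
  Σ (Subset n) λ p → (π (ie b) ≡ just p) × (H' ≡ switch H (ia b) (ib b) (ie b) u p)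

Related : ∀ {n m} → RootChoice n → Hyp n m → Hyp n m → Set
Related R = Star (SwitchStep R)

{-# OPTIONS --safe #-}
-- A history is a descending sequence of partitions of V(H), beginning with the trivial one: its classes are
-- alternately connected and anticonnected, and where that no longer refines anything a class is cut
-- at an idle hyperedge (one whose pair is not crossing) that lies on a cycle of idle hyperedges.
-- Follow such a cycle through the history to the first partition that separates it.  If this is a partition
-- into anticonnected classes, two of them can be merged.  If it is one into connected classes, an unused
-- hyperedge of the cycle can be added to the forest, at the cost of an edge separated by an earlier
-- partition into anticonnected classes, of which two can then be merged; a hyperedge cut earlier
-- is released for this purpose in the course of an augmenting sequence.  Otherwise a further cut refines
-- the partition.  So histories improve lexicographically until the idle hyperedges of the quotient
-- are acyclic, and then the last partition is skeletal.  A switch keeps the forest and only improves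
-- anticonnectivity, while it reduces the number of used hyperedges of size three.
module Submission where

open import Defs
open import Data.Nat using (ℕ; zero; suc; _+_; _*_; _<_; _≤_; z≤n; s≤s; _≤ᵇ_)
import Data.Nat.Properties as ℕₚ
open import Data.Nat.Induction using (<-wellFounded)
open import Induction.WellFounded using (Acc; acc)
open import Data.Unit using (⊤; tt)
open import Data.Empty using (⊥; ⊥-elim)
open import Data.Bool using (Bool; true; false; not; _∧_)
open import Data.Bool.ListAction using (any)
open import Data.Fin using (Fin; zero; suc; _≟_; inject₁; fromℕ; combine; remQuot)
open import Data.Fin.Properties using (any?; all?; remQuot-combine; suc-injective; inject₁-injective; fromℕ≢inject₁)
open import Data.Fin.Relation.Unary.Top using (View; view; ‵fromℕ; ‵inject₁; view-fromℕ; view-inject₁)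
open import Data.Fin.Subset using (Subset; ∣_∣; _∈_; _∉_; _⊆_; ⁅_⁆; _∪_; _─_; inside; outside)
open import Data.Fin.Subset.Properties
  using (_∈?_; ∣p∣≤n; p⊆q⇒∣p∣≤∣q∣; p⊂q⇒∣p∣<∣q∣; ⊆-antisym; ∪-identityˡ; x∈⁅x⁆; x∈⁅y⁆⇒x≡y; ∣⁅x⁆∣≡1;
         x∈p∪q⁺; x∈p∪q⁻; x∈p∧x∉q⇒x∈p─q; p─q⊆p)
import Data.List as List
open import Data.List using (List)
open import Data.Maybe using (Maybe; just; nothing)
import Data.Maybe as Maybe
import Data.Maybe.Properties as Maybeₚ
import Data.Product.Properties as Productₚ
open import Data.Product using (Σ; ∃; _×_; _,_; proj₁; proj₂)
open import Data.Sum using (_⊎_; inj₁; inj₂; [_,_]′)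
open import Data.Vec using ([]; _∷_; lookup; tabulate; fromList; _[_]≔_; here; there)
open import Data.Vec.Properties using (lookup∘tabulate; lookup⇒[]=; []=⇒lookup; lookup∘update; lookup∘update′)
open import Relation.Nullary using (¬_; Dec; yes; no)
open import Relation.Nullary.Decidable using (⌊_⌋; _×-dec_; _⊎-dec_; _→-dec_; ¬?; map′)
open import Relation.Binary.PropositionalEquality using (_≡_; _≢_; refl; sym; trans; cong; subst; ≢-sym)
open import Relation.Binary.Construct.Closure.ReflexiveTransitive using (Star; ε; _◅_; _◅◅_; reverse)
  renaming (map to ⋆-map; concat to ⋆-concat)
open import Function using (_∘_; id)

-- The cycle prevents this: a labelling closed under the other hyperedges is constant along the rest
-- of the cycle, so it agrees at `a` and `b`, and `g` still counts with its new pair (`redundant`,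
-- `neutral-add`). The argument needs the last partition to be anticonnected without `g`. Each cut
-- stores the cycle that led to it, because that cycle is the input of the later augmentation. No
-- maximal partition is ever computed: `conn`, `anti` and `cutH` steps begin with the discrete
-- partition, and a lack of maximality shows up as an obstacle or during an augmentation, where
-- classes are merged. An improvement keeps the history before its step and discards what follows.

private variable
  n m : ℕ

-- Partitions as labellings

Lab : ℕ → Set
Lab n = Fin n → Fin n

_≼_ : Lab n → Lab n → Set
P ≼ Q = ∀ {x y} → P x ≡ P y → Q x ≡ Q y

merge : Lab n → Fin n → Fin n → Lab n
merge c a b x with c x ≟ c a
... | yes _ = c b
... | no  _ = c x

merge-≼ : (c : Lab n) (a b : Fin n) → c ≼ merge c a b
merge-≼ c a b {x} {y} e with c x ≟ c a | c y ≟ c a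
... | yes _ | yes _ = refl
... | yes p | no q  = ⊥-elim (q (trans (sym e) p))
... | no q  | yes p = ⊥-elim (q (trans e p))
... | no _  | no _  = e

merge-join : (c : Lab n) (a b : Fin n) → merge c a b a ≡ merge c a b b
merge-join c a b with c a ≟ c a | c b ≟ c a
... | yes _ | yes _ = refl
... | yes _ | no  _ = refl
... | no q  | _     = ⊥-elim (q refl)

merge-inv : (c : Lab n) (a b : Fin n) {x y : Fin n} → merge c a b x ≡ merge c a b y →
  c x ≡ c y ⊎ (c x ≡ c a × c b ≡ c y) ⊎ (c x ≡ c b × c a ≡ c y)
merge-inv c a b {x} {y} e with c x ≟ c a | c y ≟ c a
... | yes p | yes q = inj₁ (trans p (sym q))
... | yes p | no _  = inj₂ (inj₁ (p , e))
... | no _  | yes q = inj₂ (inj₂ (e , sym q))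
... | no _  | no _  = inj₁ e

merge-const : {A : Set} (c : Lab n) (a b : Fin n) (f : Fin n → A) →
  (∀ {x y} → c x ≡ c y → f x ≡ f y) → f a ≡ f b →
  ∀ {x y} → merge c a b x ≡ merge c a b y → f x ≡ f y
merge-const c a b f h j e with merge-inv c a b e
... | inj₁ p = h p
... | inj₂ (inj₁ (p , q)) = trans (h p) (trans j (h q))
... | inj₂ (inj₂ (p , q)) = trans (h p) (trans (sym j) (h q))

private
  sepᵇ : Lab n → Fin (n * n) → Bool
  sepᵇ {n} c k = not ⌊ c (proj₁ (remQuot {n} n k)) ≟ c (proj₂ (remQuot {n} n k)) ⌋

  sepSet : Lab n → Subset (n * n)
  sepSet c = tabulate (sepᵇ c)

  not-does : {A : Set} (d : Dec A) → not ⌊ d ⌋ ≡ true → ¬ A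
  not-does (no q) _ = q

  does-not : {A : Set} (d : Dec A) → ¬ A → not ⌊ d ⌋ ≡ true
  does-not (yes p) q = ⊥-elim (q p)
  does-not (no _)  _ = refl

  sep∈ : (c : Lab n) (k : Fin (n * n)) → k ∈ sepSet c →
    c (proj₁ (remQuot {n} n k)) ≢ c (proj₂ (remQuot {n} n k))
  sep∈ c k p = not-does (_ ≟ _) (trans (sym (lookup∘tabulate (sepᵇ c) k)) ([]=⇒lookup p))

  ∈sep : (c : Lab n) (k : Fin (n * n)) →
    c (proj₁ (remQuot {n} n k)) ≢ c (proj₂ (remQuot {n} n k)) → k ∈ sepSet c
  ∈sep c k p = lookup⇒[]= k _ (trans (lookup∘tabulate (sepᵇ c) k) (does-not (_ ≟ _) p))

-- The measure of progress: coarsening a partition lowers it. Ordered pairs are coded in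
-- `Fin (n * n)` so that a strict inclusion of subsets gives the strict decrease, and `n * n` bounds
-- the number of successive refinements.
sep : Lab n → ℕ
sep c = ∣ sepSet c ∣

sep≤ : (c : Lab n) → sep c ≤ n * n
sep≤ c = ∣p∣≤n (sepSet c)

sep-< : (c d : Lab n) → c ≼ d → (x y : Fin n) → d x ≡ d y → c x ≢ c y → sep d < sep c
sep-< {n} c d h x y e ne = p⊂q⇒∣p∣<∣q∣
  ( (λ {k} p → ∈sep c k (λ q → sep∈ d k p (h q)))
  , combine x y
  , ∈sep c (combine x y) (λ q → ne (subst (λ z → c (proj₁ z) ≡ c (proj₂ z)) (remQuot-combine x y) q))
  , λ p → sep∈ d (combine x y) p (subst (λ z → d (proj₁ z) ≡ d (proj₂ z)) (sym (remQuot-combine x y)) e) )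

sep-≤ : (c d : Lab n) → c ≼ d → sep d ≤ sep c
sep-≤ c d h = p⊆q⇒∣p∣≤∣q∣ (λ {k} p → ∈sep c k (λ q → sep∈ d k p (h q)))

sep-merge : (c : Lab n) (a b : Fin n) → c a ≢ c b → sep (merge c a b) < sep c
sep-merge c a b = sep-< c (merge c a b) (merge-≼ c a b) a b (merge-join c a b)

any₂? : {A : Fin n → Fin m → Set} → (∀ x y → Dec (A x y)) → Dec (∃ λ x → ∃ λ y → A x y)
any₂? d = any? (λ x → any? (λ y → d x y))

module _ {E : Fin n → Fin n → Set} (E? : ∀ x y → Dec (E x y)) (E-sym : ∀ {x y} → E x y → E y x) where

  -- From the discrete labelling on, the ends of an edge with different labels are merged as long as
  -- there is one; `sep` falls each time. This also decides reachability.
  components : Σ (Lab n) λ c → (∀ {x y} → c x ≡ c y → Star E x y) × (∀ {x y} → E x y → c x ≡ c y)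
  components = go id (λ { refl → ε }) (<-wellFounded _)
    where
    go : (c : Lab n) → (∀ {x y} → c x ≡ c y → Star E x y) → Acc _<_ (sep c) →
      Σ (Lab n) λ c → (∀ {x y} → c x ≡ c y → Star E x y) × (∀ {x y} → E x y → c x ≡ c y)
    go c sound (acc rs) with any₂? (λ x y → E? x y ×-dec ¬? (c x ≟ c y))
    ... | no none = c , sound , λ {x} {y} e → decide x y e
      where
      decide : ∀ x y → E x y → c x ≡ c y
      decide x y e with c x ≟ c y
      ... | yes p = p
      ... | no q  = ⊥-elim (none (x , y , e , q))
    ... | yes (a , b , e , ne) = go (merge c a b) sound′ (rs (sep-merge c a b ne))
      where
      sound′ : ∀ {x y} → merge c a b x ≡ merge c a b y → Star E x y
      sound′ q with merge-inv c a b q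
      ... | inj₁ p = sound p
      ... | inj₂ (inj₁ (p , r)) = sound p ◅◅ e ◅ sound r
      ... | inj₂ (inj₂ (p , r)) = sound p ◅◅ E-sym e ◅ sound r

  star-label : {c : Lab n} → (∀ {x y} → E x y → c x ≡ c y) → ∀ {x y} → Star E x y → c x ≡ c y
  star-label h ε        = refl
  star-label h (e ◅ es) = trans (h e) (star-label h es)

  star? : ∀ x y → Dec (Star E x y)
  star? x y with components
  ... | c , sound , complete = map′ sound (star-label complete) (c x ≟ c y)

-- Forests as pairings

-- A quasigraph with ordered pairs in place of 2-subsets, which allows matching on the ends. The
-- order carries no meaning: `Link` forgets it, and `toQ` returns to 2-subsets.
Pairing : ℕ → ℕ → Set
Pairing n m = Fin m → Maybe (Fin n × Fin n)

set : Pairing n m → Fin m → Maybe (Fin n × Fin n) → Pairing n m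
set π g o i with i ≟ g
... | yes _ = o
... | no  _ = π i

set-same : (π : Pairing n m) (g : Fin m) (o : Maybe (Fin n × Fin n)) → set π g o g ≡ o
set-same π g o with g ≟ g
... | yes _ = refl
... | no q  = ⊥-elim (q refl)

set-other : (π : Pairing n m) {g i : Fin m} (o : Maybe (Fin n × Fin n)) → i ≢ g → set π g o i ≡ π i
set-other π {g} {i} o ne with i ≟ g
... | yes p = ⊥-elim (ne p)
... | no _  = refl

clear-nothing : (π : Pairing n m) (i : Fin m) {h : Fin m} → π h ≡ nothing → set π i nothing h ≡ nothing
clear-nothing π i {h} r with h ≟ i
... | yes _ = refl
... | no  _ = r

set-comm : (π : Pairing n m) {i g : Fin m} (o o′ : Maybe (Fin n × Fin n)) → i ≢ g →
  ∀ j → set (set π i o) g o′ j ≡ set (set π g o′) i o j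
set-comm π {i} {g} o o′ ne j with j ≟ g | j ≟ i
... | yes refl | yes refl = ⊥-elim (ne refl)
... | yes refl | no _  = sym (set-same π j o′)
... | no _  | yes refl = set-same π j o
... | no p  | no q  = trans (set-other π o q) (sym (set-other π o′ p))

just≢nothing : {A : Set} {a : A} {x : Maybe A} → x ≡ just a → x ≢ nothing
just≢nothing refl ()

just-pair : {A : Set} {a b c d : A} {x : Maybe (A × A)} → x ≡ just (a , b) → x ≡ just (c , d) → a ≡ c × b ≡ d
just-pair refl refl = refl , refl

data Link (π : Pairing n m) (i : Fin m) (x y : Fin n) : Set where
  fwd : π i ≡ just (x , y) → Link π i x y
  bwd : π i ≡ just (y , x) → Link π i x y

link-sym : {π : Pairing n m} {i : Fin m} {x y : Fin n} → Link π i x y → Link π i y x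
link-sym (fwd p) = bwd p
link-sym (bwd p) = fwd p

link-ends : {π : Pairing n m} {i : Fin m} {x y u v : Fin n} → Link π i x y → Link π i u v →
  (x ≡ u × y ≡ v) ⊎ (x ≡ v × y ≡ u)
link-ends (fwd p) (fwd q) with just-pair p q
... | e , f = inj₁ (e , f)
link-ends (fwd p) (bwd q) with just-pair p q
... | e , f = inj₂ (e , f)
link-ends (bwd p) (fwd q) with just-pair p q
... | e , f = inj₂ (f , e)
link-ends (bwd p) (bwd q) with just-pair p q
... | e , f = inj₁ (f , e)

link-cong : {π ρ : Pairing n m} {i : Fin m} {x y : Fin n} → π i ≡ ρ i → Link π i x y → Link ρ i x y
link-cong e (fwd p) = fwd (trans (sym e) p)
link-cong e (bwd p) = bwd (trans (sym e) p)

link-used : {π : Pairing n m} {i : Fin m} {x y : Fin n} → Link π i x y → π i ≢ nothing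
link-used (fwd p) = just≢nothing p
link-used (bwd p) = just≢nothing p

link-monochrome : {A : Set} {π : Pairing n m} {i : Fin m} {x y u v : Fin n} (c : Fin n → A) →
  Link π i x y → Link π i u v → c x ≡ c y → c u ≡ c v
link-monochrome c l k e with link-ends k l
... | inj₁ (refl , refl) = e
... | inj₂ (refl , refl) = sym e

All : Pairing n m → Fin n → Fin n → Set
All π x y = ∃ λ i → Link π i x y

In : Lab n → Pairing n m → Fin n → Fin n → Set
In P π x y = ∃ λ i → Link π i x y × P x ≡ P y

Av : Fin m → Pairing n m → Fin n → Fin n → Set
Av i π x y = ∃ λ j → j ≢ i × Link π j x y

AvIn : Fin m → Lab n → Pairing n m → Fin n → Fin n → Set
AvIn i P π x y = ∃ λ j → j ≢ i × Link π j x y × P x ≡ P y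

module _ {π : Pairing n m} where

  All-sym : ∀ {x y} → All π x y → All π y x
  All-sym (i , l) = i , link-sym l

  In-sym : ∀ {P x y} → In P π x y → In P π y x
  In-sym (i , l , e) = i , link-sym l , sym e

  Av-sym : ∀ {i x y} → Av i π x y → Av i π y x
  Av-sym (j , ne , l) = j , ne , link-sym l

  AvIn-sym : ∀ {i P x y} → AvIn i P π x y → AvIn i P π y x
  AvIn-sym (j , ne , l , e) = j , ne , link-sym l , sym e

  Av⇒All : ∀ {i x y} → Star (Av i π) x y → Star (All π) x y
  Av⇒All = ⋆-map (λ { (j , _ , l) → j , l })

  AvIn⇒Av : ∀ {i P x y} → Star (AvIn i P π) x y → Star (Av i π) x y
  AvIn⇒Av = ⋆-map (λ { (j , ne , l , _) → j , ne , l })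

  AvIn⇒In : ∀ {i P x y} → Star (AvIn i P π) x y → Star (In P π) x y
  AvIn⇒In = ⋆-map (λ { (j , ne , l , e) → j , l , e })

  In-class : ∀ {P x y} → Star (In P π) x y → P x ≡ P y
  In-class ε                = refl
  In-class ((_ , _ , e) ◅ w) = trans e (In-class w)

  In-coarsen : ∀ {P Q x y} → P ≼ Q → Star (In P π) x y → Star (In Q π) x y
  In-coarsen h = ⋆-map (λ { (j , l , e) → j , l , h e })

  In-avoid : ∀ {P i u v} → Link π i u v → P u ≢ P v → ∀ {x y} → In P π x y → AvIn i P π x y
  In-avoid {P} k ne (j , l , e) = j , (λ { refl → ne (link-monochrome P l k e) }) , l , e

-- Every edge is a bridge. In this form acyclicity can be used with walks that repeat vertices and
-- edges, and no simple cycle has to be extracted.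
Acyc : Pairing n m → Set
Acyc π = ∀ {i u v} → π i ≡ just (u , v) → ¬ Star (Av i π) u v

acyc-link : (π : Pairing n m) → Acyc π → ∀ {i u v} → Link π i u v → ¬ Star (Av i π) u v
acyc-link π A (fwd p) w = A p w
acyc-link π A (bwd p) w = A p (reverse Av-sym w)

link-clear : {π : Pairing n m} {e j : Fin m} {x y : Fin n} → Link (set π e nothing) j x y → j ≢ e × Link π j x y
link-clear {π = π} {e} {j} l with j ≟ e
... | yes refl = ⊥-elim (link-used l (set-same π e nothing))
... | no ne    = ne , link-cong (set-other π nothing ne) l

clear-link : {π : Pairing n m} {e j : Fin m} {x y : Fin n} → j ≢ e → Link π j x y → Link (set π e nothing) j x y
clear-link {π = π} ne = link-cong (sym (set-other π nothing ne))

acyc-resp : {π ρ : Pairing n m} → (∀ j → π j ≡ ρ j) → Acyc π → Acyc ρ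
acyc-resp h A {i} p w = A (trans (h i) p) (⋆-map (λ { (j , ne , l) → j , ne , link-cong (sym (h j)) l }) w)

acyc-clear : (π : Pairing n m) (e : Fin m) → Acyc π → Acyc (set π e nothing)
acyc-clear π e A {i} p w with link-clear {π = π} {e} {i} (fwd p)
... | _ , l = acyc-link π A l (⋆-map (λ { (j , ne , k) → j , ne , proj₂ (link-clear {π = π} k) }) w)

module _ {π : Pairing n m} {g : Fin m} (a b : Fin n) (g-unused : π g ≡ nothing) where

  private
    π′ : Pairing n m
    π′ = set π g (just (a , b))

  add-link : ∀ {j x y} → Link π j x y → Link π′ j x y
  add-link l = link-cong (sym (set-other π (just (a , b)) (λ { refl → link-used l g-unused }))) l

  added : Link π′ g a b
  added = fwd (set-same π g (just (a , b)))

  link-add : ∀ {j x y} → Link π′ j x y →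
    (j ≢ g × Link π j x y) ⊎ (j ≡ g × ((x ≡ a × y ≡ b) ⊎ (x ≡ b × y ≡ a)))
  link-add {j} l with j ≟ g
  ... | no ne    = inj₁ (ne , link-cong (set-other π _ ne) l)
  ... | yes refl = inj₂ (refl , link-ends l added)

  acyc-add : Acyc π → ¬ Star (All π) a b → Acyc π′
  acyc-add A no-walk {i} {u} {v} p w with link-add {i} (fwd p)
  ... | inj₂ (refl , _) = no-walk (subst (λ z → Star (All π) (proj₁ z) (proj₂ z)) ends (⋆-map keep w))
    where
    ends : (u , v) ≡ (a , b)
    ends with just-pair p (set-same π g (just (a , b)))
    ... | refl , refl = refl
    keep : ∀ {x y} → Av g π′ x y → All π x y
    keep (j , ne , l) with link-add {j} l
    ... | inj₁ (_ , k) = j , k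
    ... | inj₂ (e , _) = ⊥-elim (ne e)
  ... | inj₁ (_ , k) = conclude (split w)
    where
    -- What is kept of a walk in the larger graph: either the new edge can be bypassed, or a single
    -- passage through it suffices, in one of the two directions.
    Split : Fin n → Set
    Split x = Star (Av i π) x v
      ⊎ (Star (Av i π) x a × Star (Av i π) b v)
      ⊎ (Star (Av i π) x b × Star (Av i π) a v)
    split : ∀ {x} → Star (Av i π′) x v → Split x
    split ε = inj₁ ε
    split ((j , ne , l) ◅ w) with link-add {j} l | split w
    ... | inj₁ (_ , k) | inj₁ w₁ = inj₁ ((j , ne , k) ◅ w₁)
    ... | inj₁ (_ , k) | inj₂ (inj₁ (w₁ , w₂)) = inj₂ (inj₁ ((j , ne , k) ◅ w₁ , w₂))
    ... | inj₁ (_ , k) | inj₂ (inj₂ (w₁ , w₂)) = inj₂ (inj₂ ((j , ne , k) ◅ w₁ , w₂))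
    ... | inj₂ (_ , inj₁ (refl , refl)) | inj₁ w₁ = inj₂ (inj₁ (ε , w₁))
    ... | inj₂ (_ , inj₁ (refl , refl)) | inj₂ (inj₁ (_ , w₂)) = inj₂ (inj₁ (ε , w₂))
    ... | inj₂ (_ , inj₁ (refl , refl)) | inj₂ (inj₂ (_ , w₂)) = inj₁ w₂
    ... | inj₂ (_ , inj₂ (refl , refl)) | inj₁ w₁ = inj₂ (inj₂ (ε , w₁))
    ... | inj₂ (_ , inj₂ (refl , refl)) | inj₂ (inj₁ (_ , w₂)) = inj₁ w₂
    ... | inj₂ (_ , inj₂ (refl , refl)) | inj₂ (inj₂ (_ , w₂)) = inj₂ (inj₂ (ε , w₂))
    conclude : Split u → ⊥
    conclude (inj₁ w₁) = acyc-link π A k w₁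
    conclude (inj₂ (inj₁ (w₁ , w₂))) =
      no-walk (reverse All-sym (Av⇒All w₁) ◅◅ (i , k) ◅ reverse All-sym (Av⇒All w₂))
    conclude (inj₂ (inj₂ (w₁ , w₂))) =
      no-walk (Av⇒All w₂ ◅◅ (i , link-sym k) ◅ Av⇒All w₁)

-- A walk inside a P-class either stays inside a class of the finer Q or can be cut at an edge
-- crossing Q which neither remaining part uses; the last argument of across keeps what is
-- needed when an edge prepended to the walk traverses the cut edge backwards.
data Crossed (π : Pairing n m) (P Q : Lab n) (b x : Fin n) : Set where
  inside : Star (In Q π) x b → Crossed π P Q b x
  across : ∀ {i p q} → Link π i p q → P p ≡ P q → Q p ≢ Q q →
    Star (AvIn i P π) x p → Star (AvIn i P π) q b → Crossed π P Q b q → Crossed π P Q b x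

crossed : {π : Pairing n m} {P Q : Lab n} {b x : Fin n} → Q ≼ P → Star (In P π) x b → Crossed π P Q b x
crossed h ε = inside ε
crossed {Q = Q} h (_◅_ {x} {y} (j , l , e) w) with crossed h w
... | inside w₁ with Q x ≟ Q y
...   | yes p = inside ((j , l , p) ◅ w₁)
-- The remaining walk stays inside classes of `Q`, so it cannot use the crossing edge `j`.
...   | no ne = across l e ne ε (⋆-map (λ { (k , r , q) → avoid (k , r , q) }) w₁) (inside w₁)
  where
  avoid : ∀ {s t} → In Q _ s t → AvIn j _ _ s t
  avoid r with In-avoid l ne r
  ... | k , d , r′ , q = k , d , r′ , h q
crossed {Q = Q} h (_◅_ {x} {y} (j , l , e) w) | across {i} k pq ne w₁ w₂ rest with j ≟ i
... | no j≢i = across k pq ne ((j , j≢i , l , e) ◅ w₁) w₂ rest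
... | yes refl with link-ends l k
...   | inj₁ (refl , refl) = across k pq ne ε w₂ rest
...   | inj₂ (refl , refl) = rest

module _ {π : Pairing n m} (Ac : Acyc π) where

  -- The two parts of the walk lead from the ends of `i` to `a` and `b` without using `i`; a second
  -- route from `a` to `b` would close a cycle through it.
  cut-disconnects : ∀ {P i p q a b} → Link π i p q → Star (AvIn i P π) a p → Star (AvIn i P π) q b →
    ¬ Star (Av i π) a b
  cut-disconnects k w₁ w₂ w = acyc-link π Ac k
    (reverse Av-sym (AvIn⇒Av w₁) ◅◅ w ◅◅ reverse Av-sym (AvIn⇒Av w₂))

-- Anticonnectivity

module _ (H : Hyp n m) where

  _∈ₑ_ : Fin n → Fin m → Set
  x ∈ₑ f = x ∈ lookup H f

  record WF (π : Pairing n m) : Set where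
    constructor wf-intro
    field
      ends : ∀ {i u v} → π i ≡ just (u , v) → u ≢ v × u ∈ₑ i × v ∈ₑ i

  record AtMost3 : Set where
    constructor at-most-3
    field
      cover : ∀ {i u v w x} → u ≢ v → u ≢ w → v ≢ w → u ∈ₑ i → v ∈ₑ i → w ∈ₑ i → x ∈ₑ i →
        x ≡ u ⊎ x ≡ v ⊎ x ≡ w

  -- On the class of x, the hyperedge f is an obstacle to c: it is unused, or its pair lies in
  -- the class and is not separated by c.
  Free : Pairing n m → Lab n → Lab n → Fin m → Fin n → Set
  Free π P c f x = π f ≡ nothing ⊎
    ∃ λ u → ∃ λ v → π f ≡ just (u , v) × P u ≡ P x × P v ≡ P x × c u ≡ c v

  Closed : (Fin m → Set) → Pairing n m → Lab n → Lab n → Set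
  Closed S π P c = ∀ {f x y} → S f → x ∈ₑ f → y ∈ₑ f → P x ≡ P y → Free π P c f x → c x ≡ c y

  -- Every class of P is anticonnected by means of the hyperedges in S; the single labelling c tests
  -- all classes at once.
  Anti : (Fin m → Set) → Pairing n m → Lab n → Set
  Anti S π P = ∀ {c} → Closed S π P c → P ≼ c

  Every : Fin m → Set
  Every _ = ⊤

  Idle : Pairing n m → Lab n → Fin m → Set
  Idle π P f = π f ≡ nothing ⊎ ∃ λ u → ∃ λ v → π f ≡ just (u , v) × P u ≡ P v

  Transversal : Fin m → Lab n → Set
  Transversal h P = ∀ {x y} → x ∈ₑ h → y ∈ₑ h → P x ≡ P y → x ≡ y

  -- For `P` finer than `R`, a `Star` of such moves is a walk between classes of `P` along idle
  -- hyperedges other than `g`, inside one class of `R`. If it joins two vertices of `g`, it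
  -- completes `g` to a cycle.
  Chain : Pairing n m → Lab n → Lab n → Fin m → Fin n → Fin n → Set
  Chain π P R g x y = P x ≡ P y ⊎ (R x ≡ R y × ∃ λ f → f ≢ g × Idle π P f × x ∈ₑ f × y ∈ₑ f)

  -- A history of π whose last partition is P remains one of π′.
  record Neutral (π π′ : Pairing n m) (P : Lab n) : Set where
    field
      links  : ∀ {i x y} → Link π i x y → Link π′ i x y ⊎ (P x ≡ P y × Star (In P π′) x y)
      anti   : ∀ {Q} → P ≼ Q → Anti Every π Q → Anti Every π′ Q
      idle   : ∀ {Q f} → P ≼ Q → Idle π Q f → Idle π′ Q f
      used   : ∀ {e u v} → π e ≡ just (u , v) → P u ≢ P v → π′ e ≡ just (u , v)
      unused : ∀ {h} → π h ≡ nothing → Transversal h P → π′ h ≡ nothing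

ConnP : Pairing n m → Lab n → Set
ConnP π P = ∀ {x y} → P x ≡ P y → Star (In P π) x y

link-∈ : (H : Hyp n m) {π : Pairing n m} → WF H π → ∀ {i x y} → Link π i x y → _∈ₑ_ H x i × _∈ₑ_ H y i
link-∈ H wf (fwd p) = proj₂ (WF.ends wf p)
link-∈ H wf (bwd p) = proj₂ (proj₂ (WF.ends wf p)) , proj₁ (proj₂ (WF.ends wf p))

module _ {H : Hyp n m} (three : AtMost3 H) where

  private
    _∈ᵢ_ : Fin n → Fin m → Set
    _∈ᵢ_ = _∈ₑ_ H

  -- Two pairs in a set of at most three vertices intersect. So a pair lying in one class lies in
  -- the very class that its hyperedge meets twice.
  class-meet : ∀ {i u v x y} (R : Lab n) → u ≢ v → x ≢ y →
    u ∈ᵢ i → v ∈ᵢ i → x ∈ᵢ i → y ∈ᵢ i → R u ≡ R v → R x ≡ R y → R u ≡ R x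
  class-meet {u = u} {v} {x} {y} R u≢v x≢y u∈ v∈ x∈ y∈ uv xy with x ≟ u | x ≟ v
  ... | yes refl | _ = refl
  ... | no _ | yes refl = uv
  ... | no x≢u | no x≢v with AtMost3.cover three u≢v (≢-sym x≢u) (≢-sym x≢v) u∈ v∈ x∈ y∈
  ...   | inj₁ refl = sym xy
  ...   | inj₂ (inj₁ refl) = trans uv (sym xy)
  ...   | inj₂ (inj₂ refl) = ⊥-elim (x≢y refl)

  -- A hyperedge containing z outside the class of p and q meets that class only in p and q.
  trace : ∀ {i p q z x y} {A : Set} (R : Lab n) (c : Fin n → A) → p ≢ q → p ∈ᵢ i → q ∈ᵢ i → z ∈ᵢ i →
    R p ≡ R q → R p ≢ R z → c p ≡ c q → x ∈ᵢ i → y ∈ᵢ i → R x ≡ R y → c x ≡ c y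
  trace {z = z} R c p≢q p∈ q∈ z∈ pq pz e x∈ y∈ xy
    with AtMost3.cover three p≢q p≢z q≢z p∈ q∈ z∈ x∈ | AtMost3.cover three p≢q p≢z q≢z p∈ q∈ z∈ y∈
    where
    p≢z = λ r → pz (cong R r)
    q≢z = λ r → pz (trans pq (cong R r))
  ... | inj₁ refl | inj₁ refl = refl
  ... | inj₁ refl | inj₂ (inj₁ refl) = e
  ... | inj₁ refl | inj₂ (inj₂ refl) = ⊥-elim (pz xy)
  ... | inj₂ (inj₁ refl) | inj₁ refl = sym e
  ... | inj₂ (inj₁ refl) | inj₂ (inj₁ refl) = refl
  ... | inj₂ (inj₁ refl) | inj₂ (inj₂ refl) = ⊥-elim (pz (trans pq xy))
  ... | inj₂ (inj₂ refl) | inj₁ refl = ⊥-elim (pz (sym xy))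
  ... | inj₂ (inj₂ refl) | inj₂ (inj₁ refl) = ⊥-elim (pz (trans pq (sym xy)))
  ... | inj₂ (inj₂ refl) | inj₂ (inj₂ refl) = refl

  trace′ : ∀ {i p q s t x y} {A : Set} (R : Lab n) (c : Fin n → A) → p ≢ q → p ∈ᵢ i → q ∈ᵢ i →
    s ∈ᵢ i → t ∈ᵢ i → R s ≢ R t → R p ≡ R q → c p ≡ c q → x ∈ᵢ i → y ∈ᵢ i → R x ≡ R y → c x ≡ c y
  trace′ {p = p} {s = s} R c p≢q p∈ q∈ s∈ t∈ st pq e with R p ≟ R s
  ... | no ne    = trace R c p≢q p∈ q∈ s∈ pq ne e
  ... | yes same = trace R c p≢q p∈ q∈ t∈ pq (λ r → st (trans (sym same) r)) e

  closed-refine : ∀ {S π P Q c} → P ≼ Q → Closed H S π Q c → Closed H S π P c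
  closed-refine h K s x∈ y∈ e (inj₁ p) = K s x∈ y∈ (h e) (inj₁ p)
  closed-refine h K s x∈ y∈ e (inj₂ (u , v , p , q , r , t)) =
    K s x∈ y∈ (h e) (inj₂ (u , v , p , h q , h r , t))

  idle-coarsen : ∀ {π P Q f} → P ≼ Q → Idle H π P f → Idle H π Q f
  idle-coarsen h (inj₁ p) = inj₁ p
  idle-coarsen h (inj₂ (u , v , p , e)) = inj₂ (u , v , p , h e)

  -- A hyperedge with at most one vertex in each class puts no condition on a labelling.
  anti-transversal : ∀ {π P h} → Transversal H h P → Anti H (Every H) π P → Anti H (_≢ h) π P
  anti-transversal {h = h} t A {c} K = A closed
    where
    closed : Closed H (Every H) _ _ c
    closed {f} _ x∈ y∈ e fr with f ≟ h
    ... | no ne = K ne x∈ y∈ e fr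
    ... | yes refl = cong c (t x∈ y∈ e)

  module _ {π : Pairing n m} (wf : WF H π) where

    -- The pair of an idle hyperedge lies in a class of `P`, so `c` does not separate it; by
    -- `class-meet` it lies in the class of `R` that contains `x` and `y`. Hence `f` is free there.
    closed-idle : ∀ {S P R c f x y} → P ≼ R → P ≼ c → Closed H S π R c → S f →
      Idle H π P f → x ∈ᵢ f → y ∈ᵢ f → R x ≡ R y → c x ≡ c y
    closed-idle P≼R P≼c K s (inj₁ p) x∈ y∈ e = K s x∈ y∈ e (inj₁ p)
    closed-idle {x = x} {y} P≼R P≼c K s (inj₂ (u , v , p , uv)) x∈ y∈ e with x ≟ y
    ... | yes refl = refl
    ... | no x≢y with WF.ends wf p
    ...   | u≢v , u∈ , v∈ = K s x∈ y∈ e (inj₂ (u , v , p , ux , trans (sym (P≼R uv)) ux , P≼c uv))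
      where ux = class-meet _ u≢v x≢y u∈ v∈ x∈ y∈ (P≼R uv) e

    -- Classes of `P` are anticonnected without `g`, so `c` is constant on them, and then on the
    -- idle hyperedges of the chain as well. The rest of the cycle thus forces the agreement that
    -- `g` itself would force.
    redundant : ∀ {P R g} → P ≼ R → Anti H (_≢ g) π P →
      ∀ {c} → Closed H (_≢ g) π R c → ∀ {a b} → Star (Chain H π P R g) a b → c a ≡ c b
    redundant P≼R A K ε = refl
    redundant P≼R A K (inj₁ e ◅ w) = trans (A (closed-refine P≼R K) e) (redundant P≼R A K w)
    redundant P≼R A K (inj₂ (e , f , f≢g , id , x∈ , y∈) ◅ w) =
      trans (closed-idle P≼R (A (closed-refine P≼R K)) K f≢g id x∈ y∈ e) (redundant P≼R A K w)

    -- A labelling closed on the merged classes is constant on each old one, hence does not separate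
    -- the pair of `f`; being free, `f` then equates `a` and `b`.
    anti-merge : ∀ {S Q f} a b → S f → a ∈ᵢ f → b ∈ᵢ f → Idle H π Q f →
      Anti H S π Q → Anti H S π (merge Q a b)
    anti-merge {S} {Q} {f} a b s a∈ b∈ id A {c} K = merge-const Q a b c Q≼c
      (closed-idle (merge-≼ Q a b) Q≼c K s id a∈ b∈ (merge-join Q a b))
      where
      Q≼c : Q ≼ c
      Q≼c = A (closed-refine (merge-≼ Q a b) K)

  conn-neutral : ∀ {π π′ P Q} → Neutral H π π′ P → P ≼ Q → ConnP π Q → ConnP π′ Q
  conn-neutral {π} {π′} {P} {Q} N P≼Q C e = ⋆-concat (⋆-map replace (C e))
    where
    replace : ∀ {x y} → In Q π x y → Star (In Q π′) x y
    replace (i , l , e) with Neutral.links N l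
    ... | inj₁ k = (i , k , e) ◅ ε
    ... | inj₂ (_ , w) = In-coarsen P≼Q w

  neutral-coarsen : ∀ {π π′ P Q} → P ≼ Q → Neutral H π π′ P → Neutral H π π′ Q
  neutral-coarsen h N = record
    { links  = λ l → [ inj₁ , (λ { (e , w) → inj₂ (h e , In-coarsen h w) }) ]′ (links l)
    ; anti   = λ k → anti (λ e → k (h e))
    ; idle   = λ k → idle (λ e → k (h e))
    ; used   = λ p ne → used p (λ e → ne (h e))
    ; unused = λ p t → unused p (λ x∈ y∈ e → t x∈ y∈ (h e))
    } where open Neutral N

  neutral-trans : ∀ {π π₁ π₂ P} → Neutral H π π₁ P → Neutral H π₁ π₂ P → Neutral H π π₂ P
  neutral-trans {π} {π₁} {π₂} {P} N M = record
    { links  = λ l → [ N₂.links , (λ { (e , w) → inj₂ (e , ⋆-concat (⋆-map replace w)) }) ]′ (N₁.links l)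
    ; anti   = λ h A → N₂.anti h (N₁.anti h A)
    ; idle   = λ h A → N₂.idle h (N₁.idle h A)
    ; used   = λ p ne → N₂.used (N₁.used p ne) ne
    ; unused = λ p t → N₂.unused (N₁.unused p t) t
    }
    where
    module N₁ = Neutral N
    module N₂ = Neutral M
    replace : ∀ {x y} → In P π₁ x y → Star (In P π₂) x y
    replace (i , l , e) with N₂.links l
    ... | inj₁ k = (i , k , e) ◅ ε
    ... | inj₂ (_ , w) = w

  closed-clear : ∀ {S π i Q c} → Closed H S (set π i nothing) Q c → Closed H S π Q c
  closed-clear {π = π} {i} K {f} s x∈ y∈ e fr with f ≟ i
  ... | yes refl = K s x∈ y∈ e (inj₁ (set-same π i nothing))
  closed-clear {π = π} K s x∈ y∈ e (inj₁ r) | no ne = K s x∈ y∈ e (inj₁ (trans (set-other π nothing ne) r))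
  closed-clear {π = π} K s x∈ y∈ e (inj₂ (u , v , r , t)) | no ne =
    K s x∈ y∈ e (inj₂ (u , v , trans (set-other π nothing ne) r , t))

  anti-clear : ∀ {S π i Q} → Anti H S π Q → Anti H S (set π i nothing) Q
  anti-clear A K = A (closed-clear K)

  closed-resp : ∀ {S π ρ Q c} → (∀ {f} → S f → π f ≡ ρ f) → Closed H S π Q c → Closed H S ρ Q c
  closed-resp h K s x∈ y∈ e (inj₁ r) = K s x∈ y∈ e (inj₁ (trans (h s) r))
  closed-resp h K s x∈ y∈ e (inj₂ (u , v , r , t)) = K s x∈ y∈ e (inj₂ (u , v , trans (h s) r , t))

  -- The detour `w` replaces the deleted edge in connected classes, while for anticonnectivity a
  -- hyperedge without a pair is only more useful.
  neutral-clear : ∀ {π P i p q} → Link π i p q → P p ≡ P q → Star (In P (set π i nothing)) p q →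
    Neutral H π (set π i nothing) P
  neutral-clear {π} {P} {i} {p} {q} k pq w = record
    { links  = links
    ; anti   = λ _ A → anti-clear A
    ; idle   = idle
    ; used   = λ {e} r ne → trans (set-other π nothing
                 (λ { refl → ne (link-monochrome P k (fwd r) pq) })) r
    ; unused = unused
    }
    where
    π′ = set π i nothing
    links : ∀ {j x y} → Link π j x y → Link π′ j x y ⊎ (P x ≡ P y × Star (In P π′) x y)
    links {j} l with j ≟ i
    ... | no ne = inj₁ (clear-link ne l)
    ... | yes refl with link-ends l k
    ...   | inj₁ (refl , refl) = inj₂ (pq , w)
    ...   | inj₂ (refl , refl) = inj₂ (sym pq , reverse (In-sym {π = π′}) w)
    idle : ∀ {Q f} → P ≼ Q → Idle H π Q f → Idle H π′ Q f
    idle {f = f} _ I with f ≟ i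
    ... | yes refl = inj₁ refl
    ... | no ne = I
    unused : ∀ {h} → π h ≡ nothing → Transversal H h P → π′ h ≡ nothing
    unused r _ = clear-nothing π i r

  module _ {π : Pairing n m} {g : Fin m} {a b : Fin n} (g-unused : π g ≡ nothing)
    (a∈ : a ∈ᵢ g) (b∈ : b ∈ᵢ g) (a≢b : a ≢ b) where

    private
      π′ : Pairing n m
      π′ = set π g (just (a , b))

    wf-add : WF H π → WF H π′
    wf-add wf = wf-intro ends
      where
      ends : ∀ {i u v} → π′ i ≡ just (u , v) → u ≢ v × u ∈ᵢ i × v ∈ᵢ i
      ends {i} p with i ≟ g
      ends refl | yes refl = a≢b , a∈ , b∈
      ... | no _ = WF.ends wf p

    -- Any two vertices of g in one class include a or b, so g counts for π′ on that class.
    closed-unadd : ∀ {S Q c} → Q a ≡ Q b → c a ≡ c b → Closed H S π′ Q c → Closed H S π Q c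
    closed-unadd {Q = Q} {c} ab cab K {f} {x} {y} s x∈ y∈ e fr with f ≟ g
    ... | no ne = K s x∈ y∈ e (move fr)
      where
      move : Free H π Q c f x → Free H π′ Q c f x
      move (inj₁ r) = inj₁ (trans (set-other π _ ne) r)
      move (inj₂ (u , v , r , t)) = inj₂ (u , v , trans (set-other π _ ne) r , t)
    ... | yes refl with x ≟ y
    ...   | yes refl = refl
    ...   | no x≢y = K s x∈ y∈ e (inj₂ (a , b , set-same π g _ , ax , trans (sym ab) ax , cab))
      where ax = class-meet Q a≢b x≢y a∈ b∈ x∈ y∈ ab e

    -- With its pair, `g` counts only for labellings that agree at `a` and `b`. The second
    -- hypothesis grants this for every labelling closed under the other hyperedges, so nothing is
    -- lost.
    neutral-add : ∀ {P} → P a ≡ P b → (∀ {c} → Closed H (_≢ g) π P c → c a ≡ c b) →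
      Neutral H π π′ P
    neutral-add {P} ab red = record
      { links  = λ l → inj₁ (add-link a b g-unused l)
      ; anti   = λ h A K → A (closed-unadd (h ab)
                   (red (closed-refine h (closed-resp (λ {f} s → set-other π {i = f} (just (a , b)) s) (λ {f} _ → K {f} tt)))) K)
      ; idle   = idle
      ; used   = λ {e} r _ → trans (set-other π _ (λ { refl → just≢nothing r g-unused })) r
      ; unused = λ {h} r t → trans (set-other π _ (λ { refl → a≢b (t a∈ b∈ ab) })) r
      }
      where
      idle : ∀ {Q f} → P ≼ Q → Idle H π Q f → Idle H π′ Q f
      idle {f = f} h I with f ≟ g
      ... | yes refl = inj₂ (a , b , refl , h ab)
      ... | no ne = I

wf-clear : {H : Hyp n m} {π : Pairing n m} (e : Fin m) → WF H π → WF H (set π e nothing)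
wf-clear {H = H} {π} e wf = wf-intro ends
  where
  ends : ∀ {i u v} → set π e nothing i ≡ just (u , v) → u ≢ v × _∈ₑ_ H u i × _∈ₑ_ H v i
  ends {i} p with i ≟ e
  ends () | yes _
  ... | no _ = WF.ends wf p

-- Histories and augmentation

-- cutE e splits a class by deleting the edge of e, and cutH h by disregarding h.
data Kind (m : ℕ) : Set where
  conn anti : Kind m
  cutE cutH : Fin m → Kind m

-- The steps whose classes are connected. A cycle separated at such a step calls for a change of the
-- forest; at the other steps a merge of anticonnected classes is at hand.
data Splits {m} : Kind m → Set where
  conn : Splits conn
  cutE : ∀ {e} → Splits (cutE e)

data Hist (n m : ℕ) : Set where
  whole : Hist n m
  step : Hist n m → Kind m → Lab n → Hist n m

depth : Hist n m → ℕ
depth whole         = zero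
depth (step T _ _) = suc (depth T)

base : Lab n
base {zero}  ()
base {suc n} _ = zero

base-const : (x y : Fin n) → base x ≡ base y
base-const {suc n} _ _ = refl

top : Hist n m → Lab n
top whole         = base
top (step _ _ P) = P

data _⊑_ {n m} (s : Hist n m) : Hist n m → Set where
  here  : s ⊑ s
  there : ∀ {T k P} → s ⊑ T → s ⊑ step T k P

⊑-trans : {r s t : Hist n m} → r ⊑ s → s ⊑ t → r ⊑ t
⊑-trans p here      = p
⊑-trans p (there q) = there (⊑-trans p q)

⊑-depth : {s t : Hist n m} → s ⊑ t → depth s ≤ depth t
⊑-depth here      = ℕₚ.≤-refl
⊑-depth (there p) = ℕₚ.m≤n⇒m≤1+n (⊑-depth p)

module _ (H : Hyp n m) (π : Pairing n m) where

  -- The hyperedge g closes a cycle of idle hyperedges which is separated by an earlier step that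
  -- can be augmented.
  record Witness (T : Hist n m) (g : Fin m) : Set where
    field
      {R}    : Hist n m
      {kind} : Kind m
      {Q}    : Lab n
      at     : step R kind Q ⊑ T
      splits : Splits kind
      {a b}  : Fin n
      a∈     : _∈ₑ_ H a g
      b∈     : _∈ₑ_ H b g
      R-ab   : top R a ≡ top R b
      Q-ab   : Q a ≢ Q b
      chain  : Star (Chain H π (top T) (top R) g) a b

  -- By `sides`, only the class of `e` is split, into the parts at `u` and `v`; an edge between
  -- these parts can thus replace the pair of `e`. `antiT` and `redund` serve to augment at `T` with
  -- the released `e`.
  record CutE (T : Hist n m) (e : Fin m) (P : Lab n) : Set where
    field
      {u v}   : Fin n
      pair    : π e ≡ just (u , v)
      T-uv    : top T u ≡ top T v
      P-uv    : P u ≢ P v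
      sides   : ∀ {x y} → top T x ≡ top T y → P x ≢ P y → (P x ≡ P u × P y ≡ P v) ⊎ (P x ≡ P v × P y ≡ P u)
      connP   : ConnP π P
      antiT   : Anti H (Every H) π (top T)
      redund  : Witness T e

  -- `y` and `w` show that `h` meets a class of `T` twice, so the step is a proper refinement. If a
  -- merge ends the transversality, `antiT` and `redund` allow an augmentation at `T` with `h`.
  record CutH (T : Hist n m) (h : Fin m) (P : Lab n) : Set where
    field
      unused      : π h ≡ nothing
      transversal : Transversal H h P
      {y w}       : Fin n
      y∈          : _∈ₑ_ H y h
      w∈          : _∈ₑ_ H w h
      y≢w         : y ≢ w
      T-yw        : top T y ≡ top T w
      antiP       : Anti H (Every H) π P
      antiT       : Anti H (Every H) π (top T)
      redund      : Witness T h

  StepOK : Hist n m → Kind m → Lab n → Set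
  StepOK T conn     P = ConnP π P
  StepOK T anti     P = Anti H (Every H) π P
  StepOK T (cutE e) P = CutE T e P
  StepOK T (cutH h) P = CutH T h P

  Valid : Hist n m → Set
  Valid whole         = ⊤
  Valid (step T k P) = Valid T × P ≼ top T × StepOK T k P

  valid-⊑ : ∀ {s t} → s ⊑ t → Valid t → Valid s
  valid-⊑ here      V = V
  valid-⊑ (there p) V = valid-⊑ p (proj₁ V)

  valid-≼ : ∀ {s t} → s ⊑ t → Valid t → top t ≼ top s
  valid-≼ here V e = e
  valid-≼ (there p) (V , h , _) e = valid-≼ p V (h e)

  splits-conn : ∀ {T k P} → Splits k → StepOK T k P → ConnP π P
  splits-conn conn C = C
  splits-conn cutE C = CutE.connP C

module _ {H : Hyp n m} (three : AtMost3 H) {π π′ : Pairing n m} where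

  witness-neutral : ∀ {T g} → Neutral H π π′ (top T) → Witness H π T g → Witness H π′ T g
  witness-neutral {T} {g} N W = record
    { at = at ; splits = splits ; a∈ = a∈ ; b∈ = b∈ ; R-ab = R-ab ; Q-ab = Q-ab ; chain = ⋆-map move chain }
    where
    open Witness W
    move : ∀ {x y} → Chain H π (top T) (top R) g x y → Chain H π′ (top T) (top R) g x y
    move (inj₁ e) = inj₁ e
    move (inj₂ (e , f , f≢g , I , x∈ , y∈)) = inj₂ (e , f , f≢g , Neutral.idle N (λ r → r) I , x∈ , y∈)

  valid-neutral : ∀ {P} T → Neutral H π π′ P → P ≼ top T → Valid H π T → Valid H π′ T
  valid-neutral whole N h V = tt
  valid-neutral {P} (step T k Q) N h (V , r , ok) =
    valid-neutral T N (λ e → r (h e)) V , r , move k ok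
    where
    NT : Neutral H π π′ (top T)
    NT = neutral-coarsen three (λ e → r (h e)) N
    move : ∀ k → StepOK H π T k Q → StepOK H π′ T k Q
    move conn C = conn-neutral three N h C
    move anti A = Neutral.anti N h A
    move (cutE e) C = record
      { pair = Neutral.used N pair (λ q → P-uv (h q)) ; T-uv = T-uv ; P-uv = P-uv ; sides = sides
      ; connP = conn-neutral three N h connP ; antiT = Neutral.anti NT (λ q → q) antiT
      ; redund = witness-neutral NT redund }
      where open CutE C
    move (cutH e) C = record
      { unused = Neutral.unused N unused (λ x∈ y∈ q → transversal x∈ y∈ (h q)) ; transversal = transversal
      ; y∈ = y∈ ; w∈ = w∈ ; y≢w = y≢w ; T-yw = T-yw
      ; antiP = Neutral.anti N h antiP ; antiT = Neutral.anti NT (λ q → q) antiT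
      ; redund = witness-neutral NT redund }
      where open CutH C

-- OK carries what else is known about the hypergraph of an improved state.
record Better (OK : Hyp n m → Set) (T : Hist n m) : Set where
  field
    {R}    : Hist n m
    {kind} : Kind m
    {Q Q′} : Lab n
    at     : step R kind Q ⊑ T
    H      : Hyp n m
    π      : Pairing n m
    ok     : OK H
    wf     : WF H π
    acyc   : Acyc π
    valid  : Valid H π (step R kind Q′)
    less   : sep Q′ < sep Q

better-⊑ : {OK : Hyp n m → Set} {s t : Hist n m} → s ⊑ t → Better OK s → Better OK t
better-⊑ p B = record
  { at = ⊑-trans at p ; H = H ; π = π ; ok = ok ; wf = wf ; acyc = acyc ; valid = valid ; less = less }
  where open Better B

link? : (π : Pairing n m) (i : Fin m) (x y : Fin n) → Dec (Link π i x y)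
link? π i x y = map′ [ fwd , bwd ]′ (λ { (fwd p) → inj₁ p ; (bwd p) → inj₂ p })
  ((π i ≟ₚ just (x , y)) ⊎-dec (π i ≟ₚ just (y , x)))
  where
  _≟ₚ_ = Maybeₚ.≡-dec (Productₚ.≡-dec _≟_ _≟_)

joined? : (π : Pairing n m) (x y : Fin n) → Dec (All π x y)
joined? π x y = any? (λ i → link? π i x y)

in? : (P : Lab n) (π : Pairing n m) (x y : Fin n) → Dec (In P π x y)
in? P π x y = any? (λ i → link? π i x y ×-dec (P x ≟ P y))

star-separates : {E : Fin n → Fin n → Set} (c : Lab n) {a b : Fin n} → Star E a b → c a ≢ c b →
  ∃ λ x → ∃ λ y → E x y × c x ≢ c y
star-separates c ε ne = ⊥-elim (ne refl)
star-separates c (_◅_ {x} {y} e w) ne with c x ≟ c y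
... | no d  = x , y , e , d
... | yes p = star-separates c w (λ q → ne (trans p q))

transversal? : (H : Hyp n m) (h : Fin m) (P : Lab n) →
  Transversal H h P ⊎ ∃ λ x → ∃ λ y → _∈ₑ_ H x h × _∈ₑ_ H y h × P x ≡ P y × x ≢ y
transversal? H h P
  with any₂? (λ x y → (x ∈? lookup H h) ×-dec (y ∈? lookup H h) ×-dec (P x ≟ P y) ×-dec ¬? (x ≟ y))
... | yes p = inj₂ p
... | no none = inj₁ transversal
  where
  transversal : Transversal H h P
  transversal {x} {y} x∈ y∈ e with x ≟ y
  ... | yes p = p
  ... | no ne = ⊥-elim (none (x , y , x∈ , y∈ , e , ne))

conn-merge : {π : Pairing n m} {Q : Lab n} {a b : Fin n} → All π a b → ConnP π Q → ConnP π (merge Q a b)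
conn-merge {π = π} {Q} {a} {b} (i , l) C e with merge-inv Q a b e
... | inj₁ p = In-coarsen (merge-≼ Q a b) (C p)
... | inj₂ (inj₁ (p , q)) = In-coarsen (merge-≼ Q a b) (C p) ◅◅
  (i , l , merge-join Q a b) ◅ In-coarsen (merge-≼ Q a b) (C q)
... | inj₂ (inj₂ (p , q)) = In-coarsen (merge-≼ Q a b) (C p) ◅◅
  (i , link-sym l , sym (merge-join Q a b)) ◅ In-coarsen (merge-≼ Q a b) (C q)

conn-resp : {π ρ : Pairing n m} {Q : Lab n} → (∀ {i x y} → Link π i x y → Link ρ i x y) → ConnP π Q → ConnP ρ Q
conn-resp h C e = ⋆-map (λ { (i , l , q) → i , h l , q }) (C e)

module Augment (H : Hyp n m) (three : AtMost3 H) (OK : Hyp n m → Set) (ok : OK H) where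

  -- Once h is no longer transversal to a partition refining T, it is not needed in T.
  spared : ∀ {π T h Q} → Witness H π T h → Valid H π T → ∀ {s t} → Q ≼ top T → Anti H (_≢ h) π Q →
    Anti H (Every H) π (top T) →
    _∈ₑ_ H s h → _∈ₑ_ H t h → s ≢ t → Q s ≡ Q t → Anti H (_≢ h) π (top T)
  spared {π} {T} {h} {Q} W V Q≼T A A′ s∈ t∈ s≢t e {c} K = A′ closed
    where
    open Witness W
    T-ab : top T a ≢ top T b
    T-ab r = Q-ab (valid-≼ H π at V {a} {b} r)
    closed : Closed H (Every H) π (top T) c
    closed {f} s x∈ y∈ r fr with f ≟ h
    ... | no ne = K ne x∈ y∈ r fr
    ... | yes refl = trace′ three (top T) c s≢t s∈ t∈ a∈ b∈ T-ab (Q≼T e) (A {c} (closed-refine three Q≼T K) e) x∈ y∈ r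

  module _ {π : Pairing n m} (wf : WF H π) (ac : Acyc π) where

    Breaks : Hist n m → Fin n → Fin n → Set
    Breaks T a b = ∃ λ R → ∃ λ k → ∃ λ Q → step R k Q ⊑ T ×
      Star (In (top R) π) a b × ¬ Star (In Q π) a b

    -- Earlier partitions are examined first, so the break found is the first step at which `a` and
    -- `b` are no longer joined inside a class.
    breaks? : ∀ T {a b} → Star (All π) a b → Star (In (top T) π) a b ⊎ Breaks T a b
    breaks? whole w = inj₁ (⋆-map (λ { {x} {y} (i , l) → i , l , base-const x y }) w)
    breaks? (step R k Q) {a} {b} w with breaks? R w
    ... | inj₂ (R′ , k′ , Q′ , at , v , nv) = inj₂ (R′ , k′ , Q′ , there at , v , nv)
    ... | inj₁ v with star? (in? Q π) In-sym a b
    ...   | yes v′ = inj₁ v′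
    ...   | no nv  = inj₂ (R , k , Q , here , v , nv)

    -- Deleting the bridge `i` separates `a` from `b`, so the edge `ab` may be added; conversely
    -- `ab` and the two remaining parts of the walk reconnect `p` and `q` inside their class.
    exchange : ∀ {g i a b p q} P → (g-unused : π g ≡ nothing) →
      _∈ₑ_ H a g → _∈ₑ_ H b g → a ≢ b → P a ≡ P b → Link π i p q → P p ≡ P q →
      Star (AvIn i P π) a p → Star (AvIn i P π) q b →
      Neutral H π (set π g (just (a , b))) P →
      let π₂ = set (set π g (just (a , b))) i nothing in WF H π₂ × Acyc π₂ × Neutral H π π₂ P
    exchange {g} {i} {a} {b} {p} {q} P g-unused a∈ b∈ a≢b ab l pq w₁ w₂ N =
      wf-clear i (wf-add three g-unused a∈ b∈ a≢b wf) ,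
      acyc-resp {π = set (set π i nothing) g (just (a , b))} (set-comm π nothing (just (a , b)) i≢g)
        (acyc-add a b (clear-nothing π i g-unused) (acyc-clear π i ac) disconnected) ,
      neutral-trans three N (neutral-clear three (add-link a b g-unused l) pq
        (reverse (In-sym {π = π₂}) (keep w₁) ◅◅
          (g , clear-link (≢-sym i≢g) (added a b g-unused) , ab) ◅ reverse (In-sym {π = π₂}) (keep w₂)))
      where
      π₁ = set π g (just (a , b))
      π₂ = set π₁ i nothing
      i≢g : i ≢ g
      i≢g refl = link-used l g-unused
      disconnected : ¬ Star (All (set π i nothing)) a b
      disconnected w = cut-disconnects ac l w₁ w₂ (⋆-map (λ { (j , k) → j , link-clear k }) w)
      keep : ∀ {x y} → Star (AvIn i P π) x y → Star (In P π₂) x y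
      keep = ⋆-map (λ { (j , ne , k , e) → j , clear-link ne (add-link a b g-unused k) , e })

  -- `k` bounds the depth, on which the recursion runs: a recursive call concerns a strictly earlier
  -- partition, with a hyperedge released from its cut in the role of `g`.
  augment : ∀ k T {π g} → depth T ≤ k → WF H π → Acyc π → Valid H π T → π g ≡ nothing →
    Witness H π T g → Anti H (_≢ g) π (top T) → Better OK T
  augment k T {π} {g} d wf ac V g-unused W A =
    dispatch k d splits at (proj₂ (proj₂ V-step))
    where
    open Witness W
    V-step = valid-⊑ H π at V
    V-R : Valid H π R
    V-R = proj₁ V-step
    Q≼R : Q ≼ top R
    Q≼R = proj₁ (proj₂ V-step)
    T≼R : top T ≼ top R
    T≼R = valid-≼ H π (⊑-trans (there here) at) V
    a≢b : a ≢ b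
    a≢b refl = Q-ab refl
    red : ∀ {c} → Closed H (_≢ g) π (top R) c → c a ≡ c b
    red K = redundant three wf T≼R A K chain
    π₁ = set π g (just (a , b))
    N : Neutral H π π₁ (top R)
    N = neutral-add three g-unused a∈ b∈ a≢b R-ab red

    -- `R` refines `Q′`, so `a` and `b` share a class of `Q′`; if that class is connected, they are
    -- joined in it.
    no-break : ∀ {R′ k′ Q′} → step R′ k′ Q′ ⊑ R → Splits k′ → ¬ Star (In Q′ π) a b → Better OK T
    no-break at′ s nv = ⊥-elim (nv (splits-conn H π s (proj₂ (proj₂ (valid-⊑ H π at′ V-R)))
      (valid-≼ H π at′ V-R R-ab)))

    module Repair (k : ℕ) {R′ k′ Q′} (at′ : step R′ k′ Q′ ⊑ R) (d : depth R′ ≤ k)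
      (v : Star (In (top R′) π) a b) (nv : ¬ Star (In Q′ π) a b) where
      Q′≼R′ : Q′ ≼ top R′
      Q′≼R′ = proj₁ (proj₂ (valid-⊑ H π at′ V-R))
      R≼Q′ : top R ≼ Q′
      R≼Q′ = valid-≼ H π at′ V-R
      Cut : Set
      Cut = ∃ λ i → ∃ λ p → ∃ λ q → Link π i p q × top R′ p ≡ top R′ q × Q′ p ≢ Q′ q ×
        Star (AvIn i (top R′) π) a p × Star (AvIn i (top R′) π) q b
      cut : Crossed π (top R′) Q′ b a → Cut
      cut (inside w) = ⊥-elim (nv w)
      cut (across l e ne w₁ w₂ _) = _ , _ , _ , l , e , ne , w₁ , w₂
      the-cut : Cut
      the-cut = cut (crossed Q′≼R′ v)
      i = proj₁ the-cut
      p = proj₁ (proj₂ the-cut)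
      q = proj₁ (proj₂ (proj₂ the-cut))
      l : Link π i p q
      l = proj₁ (proj₂ (proj₂ (proj₂ the-cut)))
      R′-pq : top R′ p ≡ top R′ q
      R′-pq = proj₁ (proj₂ (proj₂ (proj₂ (proj₂ the-cut))))
      Q′-pq : Q′ p ≢ Q′ q
      Q′-pq = proj₁ (proj₂ (proj₂ (proj₂ (proj₂ (proj₂ the-cut)))))
      walks = proj₂ (proj₂ (proj₂ (proj₂ (proj₂ (proj₂ the-cut)))))
      R≼R′ : top R ≼ top R′
      R≼R′ e = Q′≼R′ (R≼Q′ e)
      π₂ = set π₁ i nothing
      exchanged : WF H π₂ × Acyc π₂ × Neutral H π π₂ (top R′)
      exchanged = exchange wf ac (top R′) g-unused a∈ b∈ a≢b (R≼R′ R-ab) l R′-pq (proj₁ walks) (proj₂ walks)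
        (neutral-coarsen three R≼R′ N)
      wf₂ = proj₁ exchanged
      ac₂ = proj₁ (proj₂ exchanged)
      N₂ = proj₂ (proj₂ exchanged)
      V₂ : Valid H π₂ R′
      V₂ = valid-neutral three R′ N₂ (λ e → e) (valid-⊑ H π (⊑-trans (there here) at′) V-R)
      ends : _∈ₑ_ H p i × _∈ₑ_ H q i
      ends = link-∈ H wf l
      Q₂ : Lab _
      Q₂ = merge Q′ p q
      Q₂≼R′ : Q₂ ≼ top R′
      Q₂≼R′ = merge-const Q′ p q (top R′) Q′≼R′ R′-pq
      -- The exchange as a whole is neutral only up to `R′`, since `i` crosses `Q′`. Separately,
      -- adding at `g` is neutral for `Q′`, and clearing `i` preserves anticonnectivity anyway.
      anti₂ : Anti H (Every H) π Q′ → Anti H (Every H) π₂ Q′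
      anti₂ A = anti-clear three (Neutral.anti N R≼Q′ A)
      merged : ∀ {S} → S i → Anti H S π₂ Q′ → Anti H S π₂ Q₂
      merged s A = anti-merge three wf₂ p q s (proj₁ ends) (proj₂ ends) (inj₁ (set-same π₁ i nothing)) A

      better : StepOK H π₂ R′ k′ Q₂ → Better OK T
      better ok₂ = record
        { at = ⊑-trans at′ (⊑-trans (there here) at) ; H = H ; π = π₂ ; ok = ok ; wf = wf₂ ; acyc = ac₂
        ; valid = V₂ , Q₂≼R′ , ok₂ ; less = sep-merge Q′ p q Q′-pq }

    connect : ∀ k → depth R ≤ k → step R conn Q ⊑ T → ConnP π Q → Better OK T
    connect k d at C with star? (joined? π) All-sym a b
    ... | no nw = record
      { at = at ; H = H ; π = π₁ ; ok = ok ; wf = wf-add three g-unused a∈ b∈ a≢b wf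
      ; acyc = acyc-add a b g-unused ac nw
      ; valid = valid-neutral three R N (λ e → e) V-R , merge-const Q a b (top R) Q≼R R-ab ,
          conn-merge (g , added a b g-unused) (conn-resp (add-link a b g-unused) C)
      ; less = sep-merge Q a b Q-ab }
    ... | yes w with breaks? wf ac R w
    -- The forest already joins `a` and `b` inside the class of `R`, so one of its edges connects
    -- two classes of `Q`, and these merge.
    ...   | inj₁ v with star-separates Q v Q-ab
    ...     | x , y , (i , l , e) , ne = record
      { at = at ; H = H ; π = π ; ok = ok ; wf = wf ; acyc = ac
      ; valid = V-R , merge-const Q x y (top R) Q≼R e , conn-merge (i , l) C
      ; less = sep-merge Q x y ne }
    connect k d at C | yes w | inj₂ (R′ , conn , Q′ , at′ , v , nv) = no-break at′ conn nv
    connect k d at C | yes w | inj₂ (R′ , cutE _ , Q′ , at′ , v , nv) = no-break at′ cutE nv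
    connect k d at C | yes w | inj₂ (R′ , anti , Q′ , at′ , v , nv) =
      better (merged tt (anti₂ (proj₂ (proj₂ (valid-⊑ H π at′ V-R)))))
      where open Repair k at′ (ℕₚ.≤-trans (ℕₚ.n≤1+n _) (ℕₚ.≤-trans (⊑-depth at′) d)) v nv
    connect k d at C | yes w | inj₂ (R′ , cutH h , Q′ , at′ , v , nv) = decide (transversal? H h Q₂)
      where
      open Repair k at′ (ℕₚ.≤-trans (ℕₚ.n≤1+n _) (ℕₚ.≤-trans (⊑-depth at′) d)) v nv
      open CutH (proj₂ (proj₂ (valid-⊑ H π at′ V-R)))
      i≢h : i ≢ h
      i≢h r = link-used l (trans (cong π r) unused)
      h-unused : π₂ h ≡ nothing
      h-unused = clear-nothing π₁ i {h} (Neutral.unused (neutral-coarsen three R≼Q′ N) unused transversal)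
      W₂ : Witness H π₂ R′ h
      W₂ = witness-neutral three N₂ redund
      antiT₂ : Anti H (Every H) π₂ (top R′)
      antiT₂ = Neutral.anti N₂ (λ e → e) antiT
      decide : Transversal H h Q₂ ⊎ (∃ λ x → ∃ λ y → _∈ₑ_ H x h × _∈ₑ_ H y h × Q₂ x ≡ Q₂ y × x ≢ y) → Better OK T
      decide (inj₁ t) = better record
        { unused = h-unused ; transversal = t ; y∈ = y∈ ; w∈ = w∈ ; y≢w = y≢w ; T-yw = T-yw
        ; antiP = merged tt (anti₂ antiP) ; antiT = antiT₂ ; redund = W₂ }
      -- After the merge `h` meets a class twice, so its cut cannot be kept; but that class is
      -- anticonnected without `h`, which makes `h` dispensable in `R′` and ready to receive a pair.
      decide (inj₂ (x , y , x∈ , y∈ , e , x≢y)) = better-⊑ (⊑-trans (there here) (⊑-trans at′ (⊑-trans (there here) at)))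
        (augment k R′ (ℕₚ.≤-trans (ℕₚ.n≤1+n _) (ℕₚ.≤-trans (⊑-depth at′) d)) wf₂ ac₂ V₂ h-unused W₂
          (spared W₂ V₂ Q₂≼R′ (merged i≢h (anti-transversal three transversal (anti₂ antiP))) antiT₂ x∈ y∈ x≢y e))

    release : ∀ k {e} → depth R ≤ k → step R (cutE e) Q ⊑ T → CutE H π R e Q → Better OK T
    release k {e} d at C with CutE.sides C R-ab Q-ab
    ... | sides = finish sides
      where
      open CutE C hiding (sides)
      open Witness redund using () renaming (a∈ to s∈; b∈ to t∈; Q-ab to Q-st; at to at-e)
      π₂ = set π₁ e nothing
      toward : ∀ {x y} → Q x ≡ Q y → Star (AvIn e (top R) π) x y
      toward r = ⋆-map (λ r → let k , ne , l , q = In-avoid (fwd pair) P-uv r in k , ne , l , Q≼R q) (connP r)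
      e-monochrome : ∀ {c x y} → c u ≡ c v → _∈ₑ_ H x e → _∈ₑ_ H y e → top R x ≡ top R y → c x ≡ c y
      e-monochrome {c} cuv = trace′ three (top R) c (proj₁ (WF.ends wf pair)) (proj₁ (proj₂ (WF.ends wf pair)))
        (proj₂ (proj₂ (WF.ends wf pair))) s∈ t∈ (λ r → Q-st (valid-≼ H π at-e V-R r)) T-uv cuv
      e-blocked : ∀ {c x y} → Free H π (top R) c e x → _∈ₑ_ H x e → _∈ₑ_ H y e → top R x ≡ top R y → c x ≡ c y
      e-blocked (inj₁ r) = ⊥-elim (just≢nothing pair r)
      e-blocked (inj₂ (u′ , v′ , r , _ , _ , cuv)) with just-pair pair r
      ... | refl , refl = e-monochrome cuv
      -- Some vertex of `e` lies outside the class of `u` and `v`, so `e` meets that class only in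
      -- its own pair, and while used it forced nothing there. The new pair at `g` is harmless by
      -- `red`.
      anti-e : Anti H (_≢ e) π₂ (top R)
      anti-e {c} K = antiT (closed (closed-unadd three g-unused a∈ b∈ a≢b R-ab (red without-g) K₁))
        where
        K₁ : Closed H (_≢ e) π₁ (top R) c
        K₁ = closed-resp three (λ {f} ne → set-other π₁ {i = f} nothing ne) K
        closed : Closed H (_≢ e) π (top R) c → Closed H (Every H) π (top R) c
        closed K {f} _ x∈ y∈ r fr with f ≟ e
        ... | yes refl = e-blocked fr x∈ y∈ r
        ... | no ne    = K ne x∈ y∈ r fr
        without-g : Closed H (_≢ g) π (top R) c
        without-g {f} f≢g x∈ y∈ r fr with f ≟ e
        ... | yes refl = e-blocked fr x∈ y∈ r
        ... | no ne    = closed-resp three {S = λ f → f ≢ e × f ≢ g} (λ {f} s → set-other π {i = f} (just (a , b)) (proj₂ s))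
          (λ s → K₁ (proj₁ s)) (ne , f≢g) x∈ y∈ r fr
      again : WF H π₂ × Acyc π₂ × Neutral H π π₂ (top R) → Better OK T
      again (wf₂ , ac₂ , N₂) = better-⊑ (⊑-trans (there here) at)
        (augment k R d wf₂ ac₂ (valid-neutral three R N₂ (λ r → r) V-R) (set-same π₁ e nothing)
          (witness-neutral three N₂ redund) anti-e)
      finish : (Q a ≡ Q u × Q b ≡ Q v) ⊎ (Q a ≡ Q v × Q b ≡ Q u) → Better OK T
      finish (inj₁ (p , q)) = again (exchange wf ac (top R) g-unused a∈ b∈ a≢b R-ab (fwd pair) T-uv
        (toward p) (toward (sym q)) N)
      finish (inj₂ (p , q)) = again (exchange wf ac (top R) g-unused a∈ b∈ a≢b R-ab (bwd pair) (sym T-uv)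
        (toward p) (toward (sym q)) N)

    dispatch : ∀ k → depth T ≤ k → ∀ {kd} → Splits kd → step R kd Q ⊑ T → StepOK H π R kd Q → Better OK T
    dispatch zero d s at ok with () ← ℕₚ.≤-trans (⊑-depth at) d
    dispatch (suc k) d conn at C = connect k (ℕₚ.≤-pred (ℕₚ.≤-trans (⊑-depth at) d)) at C
    dispatch (suc k) d cutE at C = release k (ℕₚ.≤-pred (ℕₚ.≤-trans (⊑-depth at) d)) at C

-- Descent through histories

module _ (H : Hyp n m) (π : Pairing n m) where

  idle? : (P : Lab n) (f : Fin m) → Dec (Idle H π P f)
  idle? P f = decide (π f)
    where
    decide : ∀ o → Dec (o ≡ nothing ⊎ ∃ λ u → ∃ λ v → o ≡ just (u , v) × P u ≡ P v)
    decide nothing = yes (inj₁ refl)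
    decide (just (u , v)) with P u ≟ P v
    ... | yes e = yes (inj₂ (u , v , refl , e))
    ... | no ne = no λ { (inj₁ ()) ; (inj₂ (_ , _ , refl , e)) → ne e }

  chain? : (P R : Lab n) (g : Fin m) (x y : Fin n) → Dec (Chain H π P R g x y)
  chain? P R g x y = (P x ≟ P y) ⊎-dec ((R x ≟ R y) ×-dec
    any? (λ f → ¬? (f ≟ g) ×-dec idle? P f ×-dec (x ∈? lookup H f) ×-dec (y ∈? lookup H f)))

  chain-sym : ∀ {P R g x y} → Chain H π P R g x y → Chain H π P R g y x
  chain-sym (inj₁ e) = inj₁ (sym e)
  chain-sym (inj₂ (e , f , ne , I , x∈ , y∈)) = inj₂ (sym e , f , ne , I , y∈ , x∈)

  -- The idle hyperedge g closes a cycle of idle hyperedges, and it is separated by the step.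
  Obstacle : Lab n → Hist n m → Lab n → Fin m → Fin n → Fin n → Set
  Obstacle P R Q g a b = Idle H π P g × _∈ₑ_ H a g × _∈ₑ_ H b g × top R a ≡ top R b × Q a ≢ Q b ×
    Star (Chain H π P (top R) g) a b

  obstacle? : ∀ P T → (∃ λ R → ∃ λ k → ∃ λ Q → step R k Q ⊑ T × ∃ λ g → ∃ λ a → ∃ λ b → Obstacle P R Q g a b)
    ⊎ (∀ {R k Q} → step R k Q ⊑ T → ∀ g a b → ¬ Obstacle P R Q g a b)
  obstacle? P whole = inj₂ λ ()
  obstacle? P (step R k Q) with obstacle? P R
  ... | inj₁ (R′ , k′ , Q′ , at , rest) = inj₁ (R′ , k′ , Q′ , there at , rest)
  ... | inj₂ none with any? (λ g → any₂? (λ a b → idle? P g ×-dec (a ∈? lookup H g) ×-dec (b ∈? lookup H g)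
    ×-dec (top R a ≟ top R b) ×-dec ¬? (Q a ≟ Q b) ×-dec star? (chain? P (top R) g) chain-sym a b))
  ...   | yes found = inj₁ (R , k , Q , here , found)
  ...   | no none′  = inj₂ λ { here g a b o → none′ (g , a , b , o) ; (there at) → none at }

data Cutting {m} : Kind m → Set where
  cutE : ∀ {e} → Cutting (cutE e)
  cutH : ∀ {h} → Cutting (cutH h)

cutting-strict : {H : Hyp n m} {π : Pairing n m} → ∀ {T k P} → Cutting k → StepOK H π T k P →
  ∃ λ x → ∃ λ y → top T x ≡ top T y × P x ≢ P y
cutting-strict cutE C = _ , _ , CutE.T-uv C , CutE.P-uv C
cutting-strict cutH C = _ , _ , CutH.T-yw C , λ e → CutH.y≢w C (CutH.transversal C (CutH.y∈ C) (CutH.w∈ C) e)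

module Resolve (H : Hyp n m) (three : AtMost3 H) (OK : Hyp n m → Set) (ok : OK H) where
  open Augment H three OK ok

  module _ {π : Pairing n m} (wf : WF H π) (ac : Acyc π) where

    -- The parts are the components, inside classes of `top T`, of the forest without the pair of
    -- `e`. A walk in a class changes its part only at `e`, which yields `sides`.
    cut-edge : ∀ {T e u v} → ConnP π (top T) → Anti H (Every H) π (top T) → π e ≡ just (u , v) →
      top T u ≡ top T v → Witness H π T e → ∃ λ P → P ≼ top T × CutE H π T e P
    cut-edge {T} {e} {u} {v} C A pair uv W = P , P≼T , record
      { pair = pair ; T-uv = uv ; P-uv = P-uv ; sides = λ r ne → sides ne (side (C r))
      ; connP = λ r → ⋆-map (λ { s@(k , _ , l , _) → k , l , complete s }) (sound r)
      ; antiT = A ; redund = W }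
      where
      parts = components (λ x y → any? (λ j → ¬? (j ≟ e) ×-dec link? π j x y ×-dec (top T x ≟ top T y))) AvIn-sym
      P = proj₁ parts
      sound : ∀ {x y} → P x ≡ P y → Star (AvIn e (top T) π) x y
      sound = proj₁ (proj₂ parts)
      complete : ∀ {x y} → AvIn e (top T) π x y → P x ≡ P y
      complete = proj₂ (proj₂ parts)
      P≼T : P ≼ top T
      P≼T r = In-class (AvIn⇒In (sound r))
      P-uv : P u ≢ P v
      P-uv r = ac pair (AvIn⇒Av (sound r))
      Side : Fin _ → Fin _ → Set
      Side x y = P x ≡ P y ⊎ (P x ≡ P u × P y ≡ P v) ⊎ (P x ≡ P v × P y ≡ P u)
      side : ∀ {x y} → Star (In (top T) π) x y → Side x y
      side ε = inj₁ refl
      side ((j , l , r) ◅ w) with j ≟ e | side w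
      ... | no ne | inj₁ p = inj₁ (trans (complete (j , ne , l , r)) p)
      ... | no ne | inj₂ (inj₁ (p , q)) = inj₂ (inj₁ (trans (complete (j , ne , l , r)) p , q))
      ... | no ne | inj₂ (inj₂ (p , q)) = inj₂ (inj₂ (trans (complete (j , ne , l , r)) p , q))
      ... | yes refl | s with link-ends l (fwd pair) | s
      ...   | inj₁ (refl , refl) | inj₁ p = inj₂ (inj₁ (refl , sym p))
      ...   | inj₁ (refl , refl) | inj₂ (inj₁ (p , q)) = ⊥-elim (P-uv (sym p))
      ...   | inj₁ (refl , refl) | inj₂ (inj₂ (p , q)) = inj₁ (sym q)
      ...   | inj₂ (refl , refl) | inj₁ p = inj₂ (inj₂ (refl , sym p))
      ...   | inj₂ (refl , refl) | inj₂ (inj₁ (p , q)) = inj₁ (sym q)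
      ...   | inj₂ (refl , refl) | inj₂ (inj₂ (p , q)) = ⊥-elim (P-uv p)
      sides : ∀ {x y} → P x ≢ P y → Side x y → (P x ≡ P u × P y ≡ P v) ⊎ (P x ≡ P v × P y ≡ P u)
      sides ne (inj₁ p) = ⊥-elim (ne p)
      sides ne (inj₂ s) = s

    Resolution : Hist n m → Set
    Resolution T = Better OK T ⊎ ∃ λ k → ∃ λ P → Cutting k × Valid H π (step T k P)

    resolve : ∀ {T R k Q g a b} → Valid H π T → ConnP π (top T) → Anti H (Every H) π (top T) →
      step R k Q ⊑ T → Obstacle H π (top T) R Q g a b → Resolution T
    resolve {T} {R} {k} {Q} {g} {a} {b} V C A at (I , a∈ , b∈ , R-ab , Q-ab , chain) = by-kind k at
      where
      T≼ : ∀ {k} → step R k Q ⊑ T → top T ≼ Q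
      T≼ at = valid-≼ H π at V
      split : ∀ {k} → Splits k → step R k Q ⊑ T → Idle H π (top T) g → Resolution T
      split {k} s at (inj₂ (u , v , p , uv)) =
        let P , P≼T , cut = cut-edge {T} C A p uv W in inj₂ (cutE g , P , cutE , V , P≼T , cut)
        where
        W : Witness H π T g
        W = record { at = at ; splits = s ; a∈ = a∈ ; b∈ = b∈ ; R-ab = R-ab ; Q-ab = Q-ab ; chain = chain }
      split {k} s at (inj₁ p) with transversal? H g (top T)
      ... | inj₁ t = inj₁ (augment (depth T) T ℕₚ.≤-refl wf ac V p
        record { at = at ; splits = s ; a∈ = a∈ ; b∈ = b∈ ; R-ab = R-ab ; Q-ab = Q-ab ; chain = chain }
        (anti-transversal three t A))
      ... | inj₂ (y , w , y∈ , w∈ , yw , y≢w) = inj₂ (cutH g , id , cutH , V , (λ { refl → refl }) , record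
        { unused = p ; transversal = λ _ _ e → e ; y∈ = y∈ ; w∈ = w∈ ; y≢w = y≢w ; T-yw = yw
        ; antiP = λ {c} _ e → cong c e ; antiT = A
        ; redund = record { at = at ; splits = s ; a∈ = a∈ ; b∈ = b∈ ; R-ab = R-ab ; Q-ab = Q-ab ; chain = chain } })
      by-kind : ∀ k → step R k Q ⊑ T → Resolution T
      by-kind conn     at = split conn at I
      by-kind (cutE e) at = split cutE at I
      -- Two anticonnected classes met by the idle `g` are merged.
      by-kind anti     at with valid-⊑ H π at V
      ... | V-R , Q≼R , A-Q = inj₁ record
        { at = at ; H = H ; π = π ; ok = ok ; wf = wf ; acyc = ac
        ; valid = V-R , merge-const Q a b (top R) Q≼R R-ab ,
            anti-merge three wf a b tt a∈ b∈ (idle-coarsen three {π = π} (T≼ at) I) A-Q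
        ; less = sep-merge Q a b Q-ab }
      by-kind (cutH h) at with valid-⊑ H π at V
      ... | V-R , Q≼R , cut = inj₁ (choose (g ≟ h))
        where
        open CutH cut
        merge-at : ∀ {f x y} → f ≢ h → Idle H π (top T) f → _∈ₑ_ H x f → _∈ₑ_ H y f →
          top R x ≡ top R y → Q x ≢ Q y → Better OK T
        merge-at {f} {x} {y} f≢h I x∈ y∈ R-xy Q-xy = decide (transversal? H h Q₂)
          where
          Q₂ = merge Q x y
          Q₂≼R : Q₂ ≼ top R
          Q₂≼R = merge-const Q x y (top R) Q≼R R-xy
          merged : ∀ {S} → S f → Anti H S π Q → Anti H S π Q₂
          merged s A = anti-merge three wf x y s x∈ y∈ (idle-coarsen three {π = π} (T≼ at) I) A
          decide : Transversal H h Q₂ ⊎ (∃ λ x → ∃ λ y → _∈ₑ_ H x h × _∈ₑ_ H y h × Q₂ x ≡ Q₂ y × x ≢ y) → Better OK T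
          decide (inj₁ t) = record
            { at = at ; H = H ; π = π ; ok = ok ; wf = wf ; acyc = ac
            ; valid = V-R , Q₂≼R , record
                { unused = unused ; transversal = t ; y∈ = y∈′ ; w∈ = w∈ ; y≢w = y≢w ; T-yw = T-yw
                ; antiP = merged tt antiP ; antiT = antiT ; redund = redund }
            ; less = sep-merge Q x y Q-xy }
            where y∈′ = CutH.y∈ cut
          decide (inj₂ (s , t , s∈ , t∈ , e , s≢t)) = better-⊑ (⊑-trans (there here) at)
            (augment (depth R) R ℕₚ.≤-refl wf ac V-R unused redund
              (spared redund V-R Q₂≼R (merged f≢h (anti-transversal three transversal antiP)) antiT s∈ t∈ s≢t e))
        choose : Dec (g ≡ h) → Better OK T
        choose (no ne) = merge-at ne I a∈ b∈ R-ab Q-ab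
        -- The disregarded `h` itself may not be used for a merge. The chain avoids it, however, and
        -- must leave the class of `a` at some other idle hyperedge.
        choose (yes refl) with star-separates Q chain Q-ab
        ... | x , y , inj₁ e , ne = ⊥-elim (ne (T≼ at e))
        ... | x , y , inj₂ (R-xy , f , f≢g , I′ , x∈ , y∈) , ne = merge-at f≢g I′ x∈ y∈ R-xy ne

-- The lexicographic recursion

module Descent (OK : Hyp n m → Set) (three : ∀ {H} → OK H → AtMost3 H) (size : Hyp n m → Pairing n m → ℕ)
  (Done : Set) where

  record State (T : Hist n m) : Set where
    field
      H     : Hyp n m
      π     : Pairing n m
      ok    : OK H
      wf    : WF H π
      acyc  : Acyc π
      valid : Valid H π T

  extend : ∀ {T k P} (S : State T) → P ≼ top T → StepOK (State.H S) (State.π S) T k P → State (step T k P)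
  extend S h ok = record
    { H = State.H S ; π = State.π S ; ok = State.ok S ; wf = State.wf S ; acyc = State.acyc S
    ; valid = State.valid S , h , ok }

  record Stable (T : Hist n m) (N : ℕ) : Set where
    field
      state : State T
    open State state public
    field
      connT : ConnP π (top T)
      antiT : Anti H (Every H) π (top T)
      bound : size H π < N

  Finish : Set
  Finish = ∀ {T N} (S : Stable T (suc N)) →
    (∀ {R k Q} → step R k Q ⊑ T → ∀ g a b → ¬ Obstacle (Stable.H S) (Stable.π S) (top T) R Q g a b) →
    (Done ⊎ Better OK T) ⊎ Stable T N

  module _ (finish : Finish) where

    Outcome : Hist n m → Set
    Outcome T = Done ⊎ Better OK T

    -- An improvement of this very step restarts `body` with the coarser partition, which terminates
    -- because `sep` falls. An improvement of an earlier step is handed down to the call that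
    -- introduced it.
    enter : ∀ {T k} → (∀ {Q} → State (step T k Q) → Outcome (step T k Q)) →
      ∀ {Q} → State (step T k Q) → Acc _<_ (sep Q) → Outcome T
    enter {T} {k} body {Q} S (acc rs) with body S
    ... | inj₁ d = inj₁ d
    ... | inj₂ B = next (Better.at B) (Better.valid B) (Better.less B)
      where
      open Better B hiding (R; kind; Q; Q′; at; valid; less)
      next : ∀ {R kd Q₁ Q₂} → step R kd Q₁ ⊑ step T k Q → Valid H π (step R kd Q₂) → sep Q₂ < sep Q₁ → Outcome T
      next here V l = enter body
        record { H = H ; π = π ; ok = ok ; wf = wf ; acyc = acyc ; valid = V } (rs l)
      next (there at) V l = inj₂ record
        { at = at ; H = H ; π = π ; ok = ok ; wf = wf ; acyc = acyc ; valid = V ; less = l }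

    -- Each further round starts from a strictly finer partition, and none separates more than
    -- `n * n` pairs, so `f` bounds the rounds still possible.
    Fuel : ℕ → Hist n m → Set
    Fuel f T = n * n < f + sep (top T)

    fuel-step : ∀ {f} {P Q : Lab n} → n * n < suc f + sep P → sep P < sep Q → n * n < f + sep Q
    fuel-step {f} {P} {Q} h l = ℕₚ.<-≤-trans h (ℕₚ.≤-trans (ℕₚ.≤-reflexive (sym (ℕₚ.+-suc f (sep P)))) (ℕₚ.+-monoʳ-≤ f l))

    mutual
      round : ∀ f {T} → Fuel f T → State T → Outcome T
      round zero {T} h S = ⊥-elim (ℕₚ.<⇒≱ h (sep≤ (top T)))
      round (suc f) {T} h S = enter connected
        (extend {P = id} S (λ { refl → refl }) (λ { refl → ε })) (<-wellFounded _)
        where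
        connected : ∀ {Q} → State (step T conn Q) → Outcome (step T conn Q)
        connected {Q} S = enter anticonnected
          (extend {P = id} S (λ { refl → refl }) (λ {c} _ e → cong c e)) (<-wellFounded _)
          where
          anticonnected : ∀ {Q₂} → State (step (step T conn Q) anti Q₂) → Outcome (step (step T conn Q) anti Q₂)
          anticonnected {Q₂} S with any₂? (λ x y → (top T x ≟ top T y) ×-dec ¬? (Q₂ x ≟ Q₂ y))
          ... | yes (x , y , e , ne) = round f (fuel-step {f} {top T} {Q₂} h (sep-< Q₂ (top T) Q₂≼T x y e ne)) S
            where
            Q₂≼T : Q₂ ≼ top T
            Q₂≼T e = proj₁ (proj₂ (proj₁ (State.valid S))) (proj₁ (proj₂ (State.valid S)) e)
          -- Neither new step refined anything, so `Q`, `Q₂` and `top T` have the same classes, and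
          -- these are both connected and anticonnected.
          ... | no none = settle f (suc (size (State.H S) (State.π S)))
            (ℕₚ.<-≤-trans h (ℕₚ.+-monoʳ-≤ (suc f) (sep-≤ Q₂ (top T) Q₂≼T)))
            record { state = S ; connT = connQ₂ ; antiT = proj₂ (proj₂ (State.valid S)) ; bound = ℕₚ.≤-refl }
            where
            Q≼T : Q ≼ top T
            Q≼T = proj₁ (proj₂ (proj₁ (State.valid S)))
            Q₂≼Q : Q₂ ≼ Q
            Q₂≼Q = proj₁ (proj₂ (State.valid S))
            Q₂≼T : Q₂ ≼ top T
            Q₂≼T e = Q≼T (Q₂≼Q e)
            Q≼Q₂ : Q ≼ Q₂
            Q≼Q₂ {x} {y} e with Q₂ x ≟ Q₂ y
            ... | yes p = p
            ... | no ne = ⊥-elim (none (x , y , Q≼T e , ne))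
            connQ₂ : ConnP (State.π S) Q₂
            connQ₂ e = In-coarsen Q≼Q₂ (proj₂ (proj₂ (proj₁ (State.valid S))) (Q₂≼Q e))

      settle : ∀ f N {T} → Fuel (suc f) T → Stable T N → Outcome T
      settle f zero h S with () ← Stable.bound S
      settle f (suc N) {T} h S with obstacle? (Stable.H S) (Stable.π S) (top T) T
      ... | inj₂ none with finish S none
      ...   | inj₁ done = done
      ...   | inj₂ S′   = settle f N h S′
      settle f (suc N) {T} h S | inj₁ (R , k , Q , at , g , a , b , o)
        with Resolve.resolve H (three ok) OK ok wf acyc valid connT antiT at o
        where open Stable S
      ... | inj₁ B = inj₂ B
      ... | inj₂ (k′ , P , cut , V) = enter further
        record { H = H ; π = π ; ok = ok ; wf = wf ; acyc = acyc ; valid = V } (<-wellFounded _)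
        where
        open Stable S
        further : ∀ {Q} → State (step T k′ Q) → Outcome (step T k′ Q)
        further {Q} S′ with cutting-strict {H = State.H S′} {π = State.π S′} cut (proj₂ (proj₂ (State.valid S′)))
        ... | x , y , e , ne = round f (fuel-step {f} {top T} {Q} h
          (sep-< Q (top T) (proj₁ (proj₂ (State.valid S′))) x y e ne)) S′

    solve : State whole → Done
    solve S with round (suc (n * n)) (s≤s (ℕₚ.m≤m+n (n * n) _)) S
    ... | inj₁ d = d
    ... | inj₂ B with () ← Better.at B

-- Small subsets

∣insert∣ : (x : Fin n) (p : Subset n) → x ∉ p → ∣ ⁅ x ⁆ ∪ p ∣ ≡ suc ∣ p ∣
∣insert∣ zero    (inside  ∷ p) x∉ = ⊥-elim (x∉ here)
∣insert∣ zero    (outside ∷ p) x∉ = cong (suc ∘ ∣_∣) (∪-identityˡ p)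
∣insert∣ (suc x) (inside  ∷ p) x∉ = cong suc (∣insert∣ x p (x∉ ∘ there))
∣insert∣ (suc x) (outside ∷ p) x∉ = ∣insert∣ x p (x∉ ∘ there)

∈insert : ∀ {x y : Fin n} {p} → y ∈ ⁅ x ⁆ ∪ p → y ≡ x ⊎ y ∈ p
∈insert {x = x} {p = p} y∈ with x∈p∪q⁻ ⁅ x ⁆ p y∈
... | inj₁ q = inj₁ (x∈⁅y⁆⇒x≡y x q)
... | inj₂ q = inj₂ q

insert⊆ : ∀ {x : Fin n} {p q} → x ∈ q → p ⊆ q → ⁅ x ⁆ ∪ p ⊆ q
insert⊆ x∈ p⊆q y∈ with ∈insert y∈
... | inj₁ refl = x∈
... | inj₂ y∈p  = p⊆q y∈p

pairSet : Fin n → Fin n → Subset n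
pairSet u v = ⁅ u ⁆ ∪ ⁅ v ⁆

∈pairˡ : (u v : Fin n) → u ∈ pairSet u v
∈pairˡ u v = x∈p∪q⁺ (inj₁ (x∈⁅x⁆ u))

∈pairʳ : (u v : Fin n) → v ∈ pairSet u v
∈pairʳ u v = x∈p∪q⁺ (inj₂ (x∈⁅x⁆ v))

∈pair⁻ : ∀ {u v x : Fin n} → x ∈ pairSet u v → x ≡ u ⊎ x ≡ v
∈pair⁻ {v = v} x∈ with ∈insert x∈
... | inj₁ p = inj₁ p
... | inj₂ p = inj₂ (x∈⁅y⁆⇒x≡y v p)

pair⊆ : ∀ {u v : Fin n} {q} → u ∈ q → v ∈ q → pairSet u v ⊆ q
pair⊆ {v = v} u∈ v∈ = insert⊆ u∈ (λ y∈ → subst (_∈ _) (sym (x∈⁅y⁆⇒x≡y v y∈)) v∈)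

∣pair∣ : ∀ {u v : Fin n} → u ≢ v → ∣ pairSet u v ∣ ≡ 2
∣pair∣ {u = u} {v} ne = trans (∣insert∣ u ⁅ v ⁆ (ne ∘ x∈⁅y⁆⇒x≡y v)) (cong suc (∣⁅x⁆∣≡1 v))

∣triple∣ : ∀ {u v w : Fin n} → u ≢ v → u ≢ w → v ≢ w → ∣ ⁅ u ⁆ ∪ pairSet v w ∣ ≡ 3
∣triple∣ {u = u} u≢v u≢w v≢w =
  trans (∣insert∣ u _ (λ u∈ → [ u≢v , u≢w ]′ (∈pair⁻ u∈))) (cong suc (∣pair∣ v≢w))

cover₂ : ∀ {u v x : Fin n} {e : Subset n} → ∣ e ∣ ≤ 2 → u ≢ v → u ∈ e → v ∈ e → x ∈ e → x ≡ u ⊎ x ≡ v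
cover₂ {u = u} {v} {x} small u≢v u∈ v∈ x∈ with x ≟ u | x ≟ v
... | yes p | _     = inj₁ p
... | no _  | yes p = inj₂ p
... | no p  | no q  = ⊥-elim (ℕₚ.<-irrefl refl (ℕₚ.≤-trans
  (subst (_≤ _) (∣triple∣ p q u≢v) (p⊆q⇒∣p∣≤∣q∣ (insert⊆ x∈ (pair⊆ u∈ v∈)))) small))

cover₃ : ∀ {u v w x : Fin n} {e : Subset n} → ∣ e ∣ ≤ 3 → u ≢ v → u ≢ w → v ≢ w →
  u ∈ e → v ∈ e → w ∈ e → x ∈ e → x ≡ u ⊎ x ≡ v ⊎ x ≡ w
cover₃ {u = u} {v} {w} {x} small u≢v u≢w v≢w u∈ v∈ w∈ x∈ with x ≟ u | x ≟ v | x ≟ w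
... | yes p | _     | _     = inj₁ p
... | no _  | yes p | _     = inj₂ (inj₁ p)
... | no _  | no _  | yes p = inj₂ (inj₂ p)
... | no p  | no q  | no r  = ⊥-elim (ℕₚ.<-irrefl refl (ℕₚ.≤-trans
  (subst (_≤ _) (trans (∣insert∣ x _ x∉) (cong suc (∣triple∣ u≢v u≢w v≢w)))
    (p⊆q⇒∣p∣≤∣q∣ (insert⊆ x∈ (insert⊆ u∈ (pair⊆ v∈ w∈))))) small))
  where
  x∉ : x ∉ ⁅ u ⁆ ∪ pairSet v w
  x∉ y∈ with ∈insert y∈
  ... | inj₁ s = p s
  ... | inj₂ s = [ q , r ]′ (∈pair⁻ s)

module _ {e : Subset n} {u : Fin n} where

  another : 2 ≤ ∣ e ∣ → ∃ λ a → a ∈ e × a ≢ u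
  another big with any? (λ a → (a ∈? e) ×-dec ¬? (a ≟ u))
  ... | yes p = p
  ... | no none = ⊥-elim (ℕₚ.<-irrefl refl (ℕₚ.≤-trans big
    (subst (∣ e ∣ ≤_) (∣⁅x⁆∣≡1 u) (p⊆q⇒∣p∣≤∣q∣ sub))))
    where
    sub : e ⊆ ⁅ u ⁆
    sub {x} x∈ with x ≟ u
    ... | yes refl = x∈⁅x⁆ u
    ... | no ne = ⊥-elim (none (x , x∈ , ne))

  third : ∀ {v} → 3 ≤ ∣ e ∣ → u ≢ v → ∃ λ a → a ∈ e × a ≢ u × a ≢ v
  third {v} big u≢v with any? (λ a → (a ∈? e) ×-dec ¬? (a ≟ u) ×-dec ¬? (a ≟ v))
  ... | yes p = p
  ... | no none = ⊥-elim (ℕₚ.<-irrefl refl (ℕₚ.≤-trans big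
    (subst (∣ e ∣ ≤_) (∣pair∣ u≢v) (p⊆q⇒∣p∣≤∣q∣ sub))))
    where
    sub : e ⊆ pairSet u v
    sub {x} x∈ with x ≟ u | x ≟ v
    ... | yes refl | _        = ∈pairˡ u v
    ... | no _     | yes refl = ∈pairʳ u v
    ... | no p     | no q     = ⊥-elim (none (x , x∈ , p , q))

three-of : {H : Hyp n m} → Is3Hyp H → AtMost3 H
three-of is3 = at-most-3 λ {i} → cover₃ (small (is3 i))
  where
  small : ∀ {k} → k ≡ 2 ⊎ k ≡ 3 → k ≤ 3
  small (inj₁ refl) = s≤s (s≤s z≤n)
  small (inj₂ refl) = s≤s (s≤s (s≤s z≤n))

-- Pairings as quasigraphs

toQ : Pairing n m → Quasi n m
toQ π i = Maybe.map (λ { (u , v) → pairSet u v }) (π i)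

module _ {π : Pairing n m} where

  toQ-just : ∀ {i u v} → π i ≡ just (u , v) → toQ π i ≡ just (pairSet u v)
  toQ-just p = cong (Maybe.map _) p

  toQ-nothing : ∀ {i} → π i ≡ nothing → toQ π i ≡ nothing
  toQ-nothing p = cong (Maybe.map _) p

  toQ-just⁻ : ∀ {i p} → toQ π i ≡ just p → ∃ λ u → ∃ λ v → π i ≡ just (u , v) × p ≡ pairSet u v
  toQ-just⁻ {i} q with π i
  toQ-just⁻ refl | just (u , v) = u , v , refl , refl

  joins-link : ∀ {i x y} → Joins (toQ π) i x y → Link π i x y
  joins-link (p , q , x∈ , y∈ , x≢y) with toQ-just⁻ q
  ... | u , v , r , refl with ∈pair⁻ x∈ | ∈pair⁻ y∈
  ...   | inj₁ refl | inj₂ refl = fwd r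
  ...   | inj₂ refl | inj₁ refl = bwd r
  ...   | inj₁ refl | inj₁ refl = ⊥-elim (x≢y refl)
  ...   | inj₂ refl | inj₂ refl = ⊥-elim (x≢y refl)

  link-joins : {H : Hyp n m} → WF H π → ∀ {i x y} → Link π i x y → Joins (toQ π) i x y
  link-joins wf {x = x} {y} (fwd p) = _ , toQ-just p , ∈pairˡ x y , ∈pairʳ x y , proj₁ (WF.ends wf p)
  link-joins wf {x = x} {y} (bwd p) = _ , toQ-just p , ∈pairʳ y x , ∈pairˡ y x , ≢-sym (proj₁ (WF.ends wf p))

  valid-toQ : {H : Hyp n m} → WF H π → ValidQ H (toQ π)
  valid-toQ wf i p q with toQ-just⁻ q
  ... | u , v , r , refl with WF.ends wf r
  ...   | u≢v , u∈ , v∈ = ∣pair∣ u≢v , pair⊆ u∈ v∈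

  -- The other edges of a cycle join the ends of its closing edge, which would then not be a bridge.
  acyclic-toQ : Acyc π → AcyclicQ (toQ π)
  acyclic-toQ A C = acyc-link π A (joins-link (Cycle.close C)) (reverse (Av-sym {π = π})
    (walk L vs es (Cycle.step C) (λ i r → fromℕ≢inject₁ (sym (Cycle.esInj C r)))))
    where
    open Cycle C using (L; vs; es)
    walk : ∀ L (vs : Fin (suc L) → Fin _) (es : Fin (suc L) → Fin _) {e} →
      (∀ i → Joins (toQ π) (es (inject₁ i)) (vs (inject₁ i)) (vs (suc i))) →
      (∀ i → es (inject₁ i) ≢ e) → Star (Av e π) (vs zero) (vs (fromℕ L))
    walk zero    vs es s ne = ε
    walk (suc L) vs es s ne = (es zero , ne zero , joins-link (s zero)) ◅
      walk L (vs ∘ suc) (es ∘ suc) (s ∘ suc) (ne ∘ suc)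

-- Cyclic sequences

next : ∀ {L} → Fin (suc L) → Fin (suc L)
next i with view i
... | ‵fromℕ     = zero
... | ‵inject₁ j = suc j

next-inject : ∀ {L} (i : Fin L) → next (inject₁ i) ≡ suc i
next-inject i rewrite view-inject₁ i = refl

next-last : ∀ L → next (fromℕ L) ≡ zero
next-last L rewrite view-fromℕ L = refl

module _ {A : Set} where

  linear : ∀ L (g : Fin (suc L) → A) → (∀ i → g (inject₁ i) ≡ g (suc i)) → g zero ≡ g (fromℕ L)
  linear zero    g h = refl
  linear (suc L) g h = trans (h zero) (linear L (g ∘ suc) (h ∘ suc))

  around : ∀ L (g : Fin (suc L) → A) (k : Fin L) → (∀ i → i ≢ k → g (inject₁ i) ≡ g (suc i)) →
    g (fromℕ L) ≡ g zero → g (inject₁ k) ≡ g (suc k)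
  around (suc L) g zero h e = trans (sym e) (sym (linear L (g ∘ suc) (λ i → h (suc i) λ ())))
  around (suc L) g (suc k) h e = around L (g ∘ suc) k (λ i ne → h (suc i) (λ { refl → ne refl }))
    (trans e (h zero λ ()))

  -- Going round the other way from `j` meets only steps at which `g` does not change. With a
  -- component labelling as `g`, this shows that a cycle without one of its hyperedges still joins
  -- the two ends.
  cyclic : ∀ {L} (g : Fin (suc L) → A) (j : Fin (suc L)) → (∀ i → i ≢ j → g i ≡ g (next i)) → g j ≡ g (next j)
  cyclic {L} g j h with view j
  ... | ‵fromℕ = sym (linear L g (λ i →
    trans (h (inject₁ i) (λ r → fromℕ≢inject₁ (sym r))) (cong g (next-inject i))))
  ... | ‵inject₁ k = around L g k
    (λ i ne → trans (h (inject₁ i) (λ r → ne (inject₁-injective r))) (cong g (next-inject i)))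
    (trans (h (fromℕ L) fromℕ≢inject₁) (cong g (next-last L)))

-- Quotients

∧-true : ∀ {a b} → a ∧ b ≡ true → a ≡ true × b ≡ true
∧-true {true} {true} refl = refl , refl

does-true : {A : Set} (d : Dec A) → ⌊ d ⌋ ≡ true → A
does-true (yes a) _ = a

true-does : {A : Set} (d : Dec A) → A → ⌊ d ⌋ ≡ true
true-does (yes _) _ = refl
true-does (no q)  a = ⊥-elim (q a)

any-tabulate⁻ : ∀ {A : Set} k (p : A → Bool) (f : Fin k → A) → any p (List.tabulate f) ≡ true → ∃ λ i → p (f i) ≡ true
any-tabulate⁻ (suc k) p f e with p (f zero) in q
... | true = zero , q
... | false with any-tabulate⁻ k p (f ∘ suc) e
...   | i , r = suc i , r

any-tabulate⁺ : ∀ {A : Set} k (p : A → Bool) (f : Fin k → A) i → p (f i) ≡ true → any p (List.tabulate f) ≡ true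
any-tabulate⁺ (suc k) p f i e with p (f zero) in q
... | true = refl
any-tabulate⁺ (suc k) p f zero e | false with () ← trans (sym e) q
any-tabulate⁺ (suc k) p f (suc i) e | false = any-tabulate⁺ k p (f ∘ suc) i e

module _ (P : Lab n) where

  private
    hit : Subset n → Fin n → Fin n → Bool
    hit e j x = lookup e x ∧ ⌊ P x ≟ j ⌋

  ∈image⁻ : ∀ {e j} → j ∈ imageS P e → ∃ λ x → x ∈ e × P x ≡ j
  ∈image⁻ {e} {j} j∈ with any-tabulate⁻ n (hit e j) id (trans (sym (lookup∘tabulate _ j)) ([]=⇒lookup j∈))
  ... | x , q with ∧-true {lookup e x} q
  ...   | r , s = x , lookup⇒[]= x e r , does-true (P x ≟ j) s

  ∈image⁺ : ∀ {e x} → x ∈ e → P x ∈ imageS P e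
  ∈image⁺ {e} {x} x∈ = lookup⇒[]= (P x) _ (trans (lookup∘tabulate _ (P x))
    (any-tabulate⁺ n (hit e (P x)) id x (both ([]=⇒lookup x∈) (true-does (P x ≟ P x) refl))))
    where
    both : ∀ {a b} → a ≡ true → b ≡ true → a ∧ b ≡ true
    both refl refl = refl

  crossing-pair : ∀ {u v} → P u ≢ P v → crossingᵇ P (pairSet u v) ≡ true
  crossing-pair {u} {v} ne = big (ℕₚ.≤-trans (ℕₚ.≤-reflexive (sym (∣pair∣ ne)))
    (p⊆q⇒∣p∣≤∣q∣ (pair⊆ (∈image⁺ (∈pairˡ u v)) (∈image⁺ (∈pairʳ u v)))))
    where
    big : ∀ {k} → 2 ≤ k → (2 ≤ᵇ k) ≡ true
    big (s≤s (s≤s _)) = refl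

  uncrossed-idle : {H : Hyp n m} {π : Pairing n m} (i : Fin m) → usedCrossingᵇ P (toQ π i) ≡ false → Idle H π P i
  uncrossed-idle {π = π} i e = decide (π i) refl e
    where
    decide : ∀ o → o ≡ π i → usedCrossingᵇ P (Maybe.map (λ { (u , v) → pairSet u v }) o) ≡ false →
      π i ≡ nothing ⊎ ∃ λ u → ∃ λ v → π i ≡ just (u , v) × P u ≡ P v
    decide nothing r _ = inj₁ (sym r)
    decide (just (u , v)) r e with P u ≟ P v
    ... | yes q = inj₂ (u , v , sym r , q)
    ... | no ne with () ← trans (sym e) (crossing-pair ne)

  -- Traces the entries of the filtered list back to hyperedges of `H`. Injectivity keeps the
  -- hyperedges of a quotient cycle distinct, so that the chain really avoids `g`.
  record Origin {m} (es : List (Subset n)) (H : Hyp n m) (ρ : Quasi n m) : Set where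
    field
      origin    : Fin (List.length es) → Fin m
      image     : ∀ i → lookup (fromList es) i ≡ imageS P (lookup H (origin i))
      uncrossed : ∀ i → usedCrossingᵇ P (ρ (origin i)) ≡ false
      injective : ∀ {i j} → origin i ≡ origin j → i ≡ j

  original : (H : Hyp n m) (ρ : Quasi n m) → Origin (unusedQuotL P H ρ) H ρ
  original [] ρ = record { origin = λ () ; image = λ () ; uncrossed = λ () ; injective = λ { {()} } }
  original (e ∷ H) ρ with crossingᵇ P e | usedCrossingᵇ P (ρ zero) in eq | original H (ρ ∘ suc)
  ... | false | _     | O = record
    { origin = suc ∘ origin ; image = image ; uncrossed = uncrossed ; injective = injective ∘ suc-injective }
    where open Origin O
  ... | true  | true  | O = record
    { origin = suc ∘ origin ; image = image ; uncrossed = uncrossed ; injective = injective ∘ suc-injective }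
    where open Origin O
  ... | true  | false | O = record
    { origin = origin′ ; image = λ { zero → refl ; (suc i) → image i }
    ; uncrossed = λ { zero → eq ; (suc i) → uncrossed i } ; injective = λ {i} {j} → injective′ i j }
    where
    open Origin O
    origin′ : Fin (suc _) → Fin (suc _)
    origin′ zero    = zero
    origin′ (suc i) = suc (origin i)
    injective′ : ∀ i j → origin′ i ≡ origin′ j → i ≡ j
    injective′ zero    zero    r = refl
    injective′ zero    (suc j) ()
    injective′ (suc i) zero    ()
    injective′ (suc i) (suc j) r = cong suc (injective (suc-injective r))

-- The partition at the end of a history without obstacles is skeletal

connected-toQ : {H : Hyp n m} {π : Pairing n m} {P : Lab n} → WF H π → ConnP π P →
  ∀ j → ConnectedOn (toQ π) (λ v → P v ≡ j)
connected-toQ {H = H} {π} {P} wf C j u v Pu Pv = convert Pu (C (trans Pu (sym Pv)))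
  where
  convert : ∀ {u} → P u ≡ j → Star (In P π) u v → ReachIn (toQ π) (λ v → P v ≡ j) u v
  convert Pu ε = hereIn Pu
  convert Pu ((i , l , e) ◅ w) = stepIn i Pu (link-joins wf l) (convert (trans (sym e) Pu) w)

free? : (H : Hyp n m) (π : Pairing n m) (P c : Lab n) (f : Fin m) (x : Fin n) → Dec (Free H π P c f x)
free? H π P c f x = decide (π f)
  where
  decide : ∀ o → Dec (o ≡ nothing ⊎ ∃ λ u → ∃ λ v → o ≡ just (u , v) × P u ≡ P x × P v ≡ P x × c u ≡ c v)
  decide nothing = yes (inj₁ refl)
  decide (just (u , v)) with (P u ≟ P x) ×-dec (P v ≟ P x) ×-dec (c u ≟ c v)
  ... | yes e = yes (inj₂ (u , v , refl , e))
  ... | no ne = no λ { (inj₁ ()) ; (inj₂ (_ , _ , refl , e)) → ne e }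

anticonnected-toQ : {H : Hyp n m} {π : Pairing n m} {P : Lab n} → Anti H (Every H) π P →
  ∀ j → AnticonnectedOn H (toQ π) (λ v → P v ≡ j)
anticonnected-toQ {H = H} {π} {P} A j c (u , v , Pu , Pv , cuv)
  with any? (λ f → any₂? (λ x y → (x ∈? lookup H f) ×-dec (y ∈? lookup H f) ×-dec (P x ≟ j) ×-dec (P y ≟ j)
    ×-dec ¬? (c x ≟ c y) ×-dec free? H π P c f x))
... | yes (f , x , y , x∈ , y∈ , Px , Py , cxy , fr) =
  f , (x , y , x∈ , y∈ , Px , Py , cxy) , quiet fr
  where
  quiet : Free H π P c f x → toQ π f ≡ nothing ⊎ Σ (Subset _) λ p → (toQ π f ≡ just p) ×
    Σ (Fin _) λ k → (x : Fin _) → x ∈ p → P x ≡ j × c x ≡ k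
  quiet (inj₁ r) = inj₁ (toQ-nothing {π = π} r)
  quiet (inj₂ (a , b , r , ax , bx , cab)) = inj₂ (_ , toQ-just {π = π} r , c a , λ y y∈ →
    [ (λ { refl → trans ax Px , refl }) , (λ { refl → trans bx Px , sym cab }) ]′ (∈pair⁻ y∈))
... | no none = ⊥-elim (cuv (trans (sym (in-class Pu)) (trans (A {c′} closed (trans Pu (sym Pv))) (in-class Pv))))
  where
  -- `Anti` tests all classes at once, so `c` is made constant off the class `j`, where it then
  -- imposes nothing; the value `c u` is arbitrary.
  c′ : Lab _
  c′ x with P x ≟ j
  ... | yes _ = c x
  ... | no  _ = c u
  in-class : ∀ {x} → P x ≡ j → c′ x ≡ c x
  in-class {x} e with P x ≟ j
  ... | yes _ = refl
  ... | no ne = ⊥-elim (ne e)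
  off-class : ∀ {x} → P x ≢ j → c′ x ≡ c u
  off-class {x} ne with P x ≟ j
  ... | yes e = ⊥-elim (ne e)
  ... | no _  = refl
  closed : Closed H (Every H) π P c′
  closed {f} {x} {y} _ x∈ y∈ xy fr = by-class (P x ≟ j)
    where
    transfer : P x ≡ j → Free H π P c′ f x → Free H π P c f x
    transfer Px (inj₁ r) = inj₁ r
    transfer Px (inj₂ (a , b , r , ax , bx , cab)) = inj₂ (a , b , r , ax , bx ,
      trans (sym (in-class (trans ax Px))) (trans cab (in-class (trans bx Px))))
    by-class : Dec (P x ≡ j) → c′ x ≡ c′ y
    by-class (no ne) = trans (off-class ne) (sym (off-class (λ e → ne (trans xy e))))
    by-class (yes Px) with c x ≟ c y
    ... | yes e = trans (in-class Px) (trans e (sym (in-class (trans (sym xy) Px))))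
    ... | no ne = ⊥-elim (none (f , x , y , x∈ , y∈ , Px , trans (sym xy) Px , ne , transfer Px fr))

module _ {H : Hyp n m} {π : Pairing n m} (T : Hist n m) (V : Valid H π T)
  (none : ∀ {R k Q} → step R k Q ⊑ T → ∀ g a b → ¬ Obstacle H π (top T) R Q g a b) where

  private
    P = top T

  -- A quotient cycle is lifted to idle hyperedges `f i` with vertices `y i` and `z i` in
  -- consecutive classes. By induction along the history no partition separates `y i` from `z i`:
  -- the first to do so would give an obstacle, with the rest of the cycle as its chain. At the last
  -- partition two distinct classes of the cycle would coincide.
  acyclic-quotient : AcyclicHyp (UnusedQuot P H (toQ π))
  acyclic-quotient ρ valid (C , _) = zero≢next L≥1
    (vsInj (trans (sym (y-label zero)) (trans (level T here zero) (z-label zero))))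
    where
    open Cycle C hiding (step)
    open Origin (original P H (toQ π))
    zero≢next : ∀ {L} → 1 ≤ L → zero {n = L} ≢ next zero
    zero≢next (s≤s _) ()
    joins : ∀ i → Joins ρ (es i) (vs i) (vs (next i))
    joins i = go (view i)
      where
      go : ∀ {i} → View i → Joins ρ (es i) (vs i) (vs (next i))
      go ‵fromℕ       = subst (λ j → Joins ρ (es (fromℕ L)) (vs (fromℕ L)) (vs j)) (sym (next-last L)) close
      go (‵inject₁ i) = subst (λ j → Joins ρ (es (inject₁ i)) (vs (inject₁ i)) (vs j)) (sym (next-inject i)) (Cycle.step C i)
    f : Fin (suc L) → Fin _
    f i = origin (es i)
    lift : ∀ i {j} → (∀ p → ρ (es i) ≡ just p → p ⊆ lookup (UnusedQuot P H (toQ π)) (es i)) →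
      (∃ λ p → (ρ (es i) ≡ just p) × j ∈ p) → ∃ λ x → x ∈ lookup H (f i) × P x ≡ j
    lift i sub (p , q , j∈) = ∈image⁻ P (subst (_ ∈_) (image (es i)) (sub p q j∈))
    start : ∀ i → ∃ λ x → x ∈ lookup H (f i) × P x ≡ vs i
    start i = let p , q , j∈ , _ = joins i in lift i (λ p q → proj₂ (valid (es i) p q)) (p , q , j∈)
    end : ∀ i → ∃ λ x → x ∈ lookup H (f i) × P x ≡ vs (next i)
    end i = let p , q , _ , j∈ , _ = joins i in lift i (λ p q → proj₂ (valid (es i) p q)) (p , q , j∈)
    y z : Fin (suc L) → Fin _
    y i = proj₁ (start i)
    z i = proj₁ (end i)
    y∈ : ∀ i → y i ∈ lookup H (f i)
    y∈ i = proj₁ (proj₂ (start i))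
    z∈ : ∀ i → z i ∈ lookup H (f i)
    z∈ i = proj₁ (proj₂ (end i))
    y-label : ∀ i → P (y i) ≡ vs i
    y-label i = proj₂ (proj₂ (start i))
    z-label : ∀ i → P (z i) ≡ vs (next i)
    z-label i = proj₂ (proj₂ (end i))
    idle : ∀ i → Idle H π P (f i)
    idle i = uncrossed-idle P {H = H} {π = π} (f i) (uncrossed (es i))
    level : ∀ s → s ⊑ T → ∀ i → top s (y i) ≡ top s (z i)
    level whole at i = base-const _ _
    level (step R k Q) at i with Q (y i) ≟ Q (z i)
    ... | yes e = e
    ... | no ne = ⊥-elim (none at (f i) (y i) (z i) (idle i , y∈ i , z∈ i , below i , ne , chain))
      where
      below : ∀ i → top R (y i) ≡ top R (z i)
      below = level R (⊑-trans (there here) at)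
      parts = components (chain? H π P (top R) (f i)) (chain-sym H π)
      c = proj₁ parts
      complete : ∀ {x y} → Chain H π P (top R) (f i) x y → c x ≡ c y
      complete = proj₂ (proj₂ parts)
      to-next : ∀ j → c (z j) ≡ c (y (next j))
      to-next j = complete (inj₁ (trans (z-label j) (sym (y-label (next j)))))
      chain : Star (Chain H π P (top R) (f i)) (y i) (z i)
      chain = proj₁ (proj₂ parts) (trans
        (cyclic (c ∘ y) i (λ j ne → trans
          (complete (inj₂ (below j , f j , (λ r → ne (esInj (injective r))) , idle j , y∈ j , z∈ j))) (to-next j)))
        (sym (to-next i)))

  skeletal : WF H π → ConnP π P → Anti H (Every H) π P → Skeletal H (toQ π) P
  skeletal wf C A = (λ j → connected-toQ wf C j , anticonnected-toQ {H = H} {π} A j) , acyclic-quotient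

∉─ : ∀ {x : Fin n} (p q : Subset n) → x ∈ p ─ q → x ∉ q
∉─ (inside  ∷ p) (outside ∷ q) here ()
∉─ (_ ∷ p) (_ ∷ q) (there x∈) (there x∈q) = ∉─ p q x∈ x∈q

-- Deciding bad leaves

module _ {H : Hyp n m} {π : Pairing n m} (wf : WF H π) where

  joins? : ∀ i u v → Dec (Joins (toQ π) i u v)
  joins? i u v = map′ (link-joins wf) joins-link (link? π i u v)

  reachAvoid? : ∀ i u v → Dec (ReachAvoid (toQ π) i u v)
  reachAvoid? i u v = map′ to from
    (star? (λ x y → any? (λ j → ¬? (j ≟ i) ×-dec link? π j x y)) (Av-sym {π = π}) u v)
    where
    to : ∀ {u} → Star (Av i π) u v → ReachAvoid (toQ π) i u v
    to ε                  = hereAv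
    to ((j , ne , l) ◅ w) = stepAv j ne (link-joins wf l) (to w)
    from : ∀ {u} → ReachAvoid (toQ π) i u v → Star (Av i π) u v
    from hereAv            = ε
    from (stepAv j ne l w) = (j , ne , joins-link l) ◅ from w

  badLeaf? : ∀ R u → Dec (BadLeaf R H (toQ π) u)
  badLeaf? R u = map′
    (λ { (a , b , e , ab , ae , be , sa , sb , se , ua , ub , ue , only , leaf , tail) → record
      { ia = a ; ib = b ; ie = e ; ia≢ib = ab ; ia≢ie = ae ; ib≢ie = be ; sa = sa ; sb = sb ; se = se
      ; ua = ua ; ub = ub ; ue = ue ; only3 = only ; leaf = leaf ; assoc = tail } })
    (λ b → ia b , ib b , ie b , ia≢ib b , ia≢ie b , ib≢ie b , sa b , sb b , se b , ua b , ub b , ue b ,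
      only3 b , leaf b , assoc b)
    (any? λ a → any? λ b → any? λ e → ¬? (a ≟ b) ×-dec ¬? (a ≟ e) ×-dec ¬? (b ≟ e) ×-dec
      (∣ lookup H a ∣ ℕₚ.≟ 2) ×-dec (∣ lookup H b ∣ ℕₚ.≟ 2) ×-dec (∣ lookup H e ∣ ℕₚ.≟ 3) ×-dec
      (u ∈? lookup H a) ×-dec (u ∈? lookup H b) ×-dec (u ∈? lookup H e) ×-dec
      all? (λ j → (u ∈? lookup H j) →-dec ((j ≟ a) ⊎-dec (j ≟ b) ⊎-dec (j ≟ e))) ×-dec
      all? (λ j → leaf? (toQ π j) (j ≟ e)) ×-dec
      any? (λ v → joins? e u v ×-dec reachAvoid? e v (RootChoice.root R (adjQ (toQ π)) u)))
    where
    leaf? : ∀ {A : Set} (o : Maybe (Subset _)) → Dec A → Dec (∀ p → o ≡ just p → u ∈ p → A)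
    leaf? nothing  A? = yes λ _ ()
    leaf? (just q) A? = map′ (λ { h _ refl → h }) (λ h → h q refl) ((u ∈? q) →-dec A?)

-- Switching at a bad leaf

used3 : Hyp n m → Pairing n m → Fin m → Bool
used3 H π i with π i
... | nothing = false
... | just _  = ⌊ ∣ lookup H i ∣ ℕₚ.≟ 3 ⌋

#used3 : Hyp n m → Pairing n m → ℕ
#used3 H π = ∣ tabulate (used3 H π) ∣

module Switch {roots : RootChoice n} {H : Hyp n m} {π : Pairing n m} (is3 : Is3Hyp H) (wf : WF H π)
  {u : Fin n} (leafᵤ : BadLeaf roots H (toQ π) u) where

  private
    three : AtMost3 H
    three = three-of is3
    A B E : Fin m
    A = ia leafᵤ
    B = ib leafᵤ
    E = ie leafᵤ
    A≢B = ia≢ib leafᵤ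
    A≢E = ia≢ie leafᵤ
    B≢E = ib≢ie leafᵤ
    c : Fin n
    c = proj₁ (assoc leafᵤ)
    joined : Joins (toQ π) E u c
    joined = proj₁ (proj₂ (assoc leafᵤ))
    link : Link π E u c
    link = joins-link joined
    u≢c : u ≢ c
    u≢c = proj₂ (proj₂ (proj₂ (proj₂ joined)))
    c∈E : c ∈ lookup H E
    c∈E = proj₂ (link-∈ H wf link)

  p : Subset n
  p = proj₁ joined

  π-E : toQ π E ≡ just p
  π-E = proj₁ (proj₂ joined)

  H′ : Hyp n m
  H′ = switch H A B E u p

  private
    u∈p : u ∈ p
    u∈p = proj₁ (proj₂ (proj₂ joined))
    c∈p : c ∈ p
    c∈p = proj₁ (proj₂ (proj₂ (proj₂ joined)))
    ∣p∣ : ∣ p ∣ ≡ 2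
    ∣p∣ = proj₁ (valid-toQ wf E p π-E)

    d-spec : ∃ λ d → d ∈ lookup H E × d ≢ u × d ≢ c
    d-spec = third (ℕₚ.≤-reflexive (sym (se leafᵤ))) u≢c
    d : Fin n
    d = proj₁ d-spec
    d∈E = proj₁ (proj₂ d-spec)
    d≢u = proj₁ (proj₂ (proj₂ d-spec))
    d≢c = proj₂ (proj₂ (proj₂ d-spec))

    E-cover : ∀ {x} → x ∈ lookup H E → x ≡ u ⊎ x ≡ c ⊎ x ≡ d
    E-cover = AtMost3.cover three u≢c (≢-sym d≢u) (≢-sym d≢c) (ue leafᵤ) c∈E d∈E

    unused : ∀ {i} → ∣ lookup H i ∣ ≡ 2 → u ∈ lookup H i → i ≢ E → π i ≡ nothing
    unused {i} two u∈ ne with π i in eq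
    ... | nothing = refl
    ... | just (x , y) with WF.ends wf eq
    ...   | x≢y , x∈ , y∈ = ⊥-elim (ne (leaf leafᵤ i _ (toQ-just {π = π} eq) (end (cover₂ (ℕₚ.≤-reflexive two) x≢y x∈ y∈ u∈))))
      where
      end : u ≡ x ⊎ u ≡ y → u ∈ pairSet x y
      end (inj₁ refl) = ∈pairˡ x y
      end (inj₂ refl) = ∈pairʳ x y

    A-unused : π A ≡ nothing
    A-unused = unused (sa leafᵤ) (ua leafᵤ) A≢E
    B-unused : π B ≡ nothing
    B-unused = unused (sb leafᵤ) (ub leafᵤ) B≢E

    uab ud : Subset n
    uab = lookup H A ∪ lookup H B
    ud  = (lookup H E ─ p) ∪ ⁅ u ⁆
    H-A H-AB : Hyp n m
    H-A  = H [ A ]≔ uab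
    H-AB = H-A [ B ]≔ ud
    at-E : lookup H′ E ≡ p
    at-E = lookup∘update E H-AB p
    at-B : lookup H′ B ≡ ud
    at-B = trans (lookup∘update′ B≢E H-AB p) (lookup∘update B H-A ud)
    at-A : lookup H′ A ≡ uab
    at-A = trans (lookup∘update′ A≢E H-AB p) (trans (lookup∘update′ A≢B H-A ud) (lookup∘update A H uab))
    elsewhere : ∀ {i} → i ≢ A → i ≢ B → i ≢ E → lookup H′ i ≡ lookup H i
    elsewhere i≢A i≢B i≢E = trans (lookup∘update′ i≢E H-AB p)
      (trans (lookup∘update′ i≢B H-A ud) (lookup∘update′ i≢A H uab))

    A⊆A′ : lookup H A ⊆ lookup H′ A
    A⊆A′ {x} x∈ = subst (x ∈_) (sym at-A) (x∈p∪q⁺ (inj₁ x∈))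
    B⊆A′ : lookup H B ⊆ lookup H′ A
    B⊆A′ {x} x∈ = subst (x ∈_) (sym at-A) (x∈p∪q⁺ (inj₂ x∈))
    u∈B′ : u ∈ lookup H′ B
    u∈B′ = subst (u ∈_) (sym at-B) (x∈p∪q⁺ (inj₂ (x∈⁅x⁆ u)))
    p-cover : ∀ {x} → x ∈ p → x ≡ u ⊎ x ≡ c
    p-cover = cover₂ (ℕₚ.≤-reflexive ∣p∣) u≢c u∈p c∈p
    d∈B′ : d ∈ lookup H′ B
    d∈B′ = subst (d ∈_) (sym at-B) (x∈p∪q⁺ (inj₁ (x∈p∧x∉q⇒x∈p─q d∈E (λ d∈p → [ d≢u , d≢c ]′ (p-cover d∈p)))))
    B′-cover : ∀ {x} → x ∈ lookup H′ B → x ≡ u ⊎ x ≡ d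
    B′-cover {x} x∈ with x∈p∪q⁻ (lookup H E ─ p) ⁅ u ⁆ (subst (_ ∈_) at-B x∈)
    ... | inj₂ x∈u = inj₁ (x∈⁅y⁆⇒x≡y u x∈u)
    ... | inj₁ x∈d with E-cover (p─q⊆p (lookup H E) p x∈d)
    ...   | inj₁ refl        = inj₁ refl
    ...   | inj₂ (inj₁ refl) = ⊥-elim (∉─ (lookup H E) p x∈d c∈p)
    ...   | inj₂ (inj₂ refl) = inj₂ refl

  is3′ : Is3Hyp H′
  is3′ i with i ≟ E | i ≟ B | i ≟ A
  ... | yes refl | _ | _ = inj₁ (trans (cong ∣_∣ at-E) ∣p∣)
  ... | no _ | yes refl | _ = inj₁ (trans (cong ∣_∣ (⊆-antisym
    (λ x∈ → [ (λ { refl → ∈pairˡ u d }) , (λ { refl → ∈pairʳ u d }) ]′ (B′-cover x∈)) (pair⊆ u∈B′ d∈B′)))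
    (∣pair∣ (≢-sym d≢u)))
  ... | no i≢E | no i≢B | no i≢A = subst (λ e → ∣ e ∣ ≡ 2 ⊎ ∣ e ∣ ≡ 3) (sym (elsewhere i≢A i≢B i≢E)) (is3 i)
  ... | no _ | no _ | yes refl with another {e = lookup H A} {u} (ℕₚ.≤-reflexive (sym (sa leafᵤ)))
                                  | another {e = lookup H B} {u} (ℕₚ.≤-reflexive (sym (sb leafᵤ)))
  ...   | a , a∈ , a≢u | b , b∈ , b≢u with a ≟ b
  -- The hyperedges `ua` and `ub` may be parallel; then `uab` has size two.
  ...     | yes refl = inj₁ (trans (cong ∣_∣ (⊆-antisym incl (pair⊆ (A⊆A′ (ua leafᵤ)) (A⊆A′ a∈)))) (∣pair∣ (≢-sym a≢u)))
    where
    to : ∀ {x} → x ≡ u ⊎ x ≡ a → x ∈ pairSet u a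
    to (inj₁ refl) = ∈pairˡ u a
    to (inj₂ refl) = ∈pairʳ u a
    incl : lookup H′ A ⊆ pairSet u a
    incl x∈ with x∈p∪q⁻ (lookup H A) (lookup H B) (subst (_ ∈_) at-A x∈)
    ... | inj₁ y∈ = to (cover₂ (ℕₚ.≤-reflexive (sa leafᵤ)) (≢-sym a≢u) (ua leafᵤ) a∈ y∈)
    ... | inj₂ y∈ = to (cover₂ (ℕₚ.≤-reflexive (sb leafᵤ)) (≢-sym b≢u) (ub leafᵤ) b∈ y∈)
  ...     | no a≢b = inj₂ (trans (cong ∣_∣ (⊆-antisym incl
      (insert⊆ (A⊆A′ (ua leafᵤ)) (pair⊆ (A⊆A′ a∈) (B⊆A′ b∈))))) (∣triple∣ (≢-sym a≢u) (≢-sym b≢u) a≢b))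
    where
    incl : lookup H′ A ⊆ ⁅ u ⁆ ∪ pairSet a b
    incl x∈ with x∈p∪q⁻ (lookup H A) (lookup H B) (subst (_ ∈_) at-A x∈)
    ... | inj₁ y∈ with cover₂ (ℕₚ.≤-reflexive (sa leafᵤ)) (≢-sym a≢u) (ua leafᵤ) a∈ y∈
    ...   | inj₁ refl = x∈p∪q⁺ (inj₁ (x∈⁅x⁆ u))
    ...   | inj₂ refl = x∈p∪q⁺ (inj₂ (∈pairˡ a b))
    incl x∈ | inj₂ y∈ with cover₂ (ℕₚ.≤-reflexive (sb leafᵤ)) (≢-sym b≢u) (ub leafᵤ) b∈ y∈
    ...   | inj₁ refl = x∈p∪q⁺ (inj₁ (x∈⁅x⁆ u))
    ...   | inj₂ refl = x∈p∪q⁺ (inj₂ (∈pairʳ a b))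

  wf′ : WF H′ π
  wf′ = wf-intro ends
    where
    ends : ∀ {i x y} → π i ≡ just (x , y) → x ≢ y × x ∈ lookup H′ i × y ∈ lookup H′ i
    ends {i} q with WF.ends wf q | i ≟ E | i ≟ A | i ≟ B
    ... | x≢y , x∈ , y∈ | _ | yes refl | _ = ⊥-elim (just≢nothing q A-unused)
    ... | x≢y , x∈ , y∈ | _ | _ | yes refl = ⊥-elim (just≢nothing q B-unused)
    ... | x≢y , x∈ , y∈ | no i≢E | no i≢A | no i≢B = x≢y ,
      subst (_ ∈_) (sym (elsewhere i≢A i≢B i≢E)) x∈ , subst (_ ∈_) (sym (elsewhere i≢A i≢B i≢E)) y∈
    ... | x≢y , x∈ , y∈ | yes refl | no _ | no _ with link-ends (fwd q) link
    ...   | inj₁ (refl , refl) = x≢y , subst (_ ∈_) (sym at-E) u∈p , subst (_ ∈_) (sym at-E) c∈p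
    ...   | inj₂ (refl , refl) = x≢y , subst (_ ∈_) (sym at-E) c∈p , subst (_ ∈_) (sym at-E) u∈p

  fewer : #used3 H′ π < #used3 H π
  fewer = p⊂q⇒∣p∣<∣q∣ ((λ {k} k∈ → to (keep k (from k∈))) , E , to E-used , λ E∈ → E-unused (from E∈))
    where
    to : ∀ {G k} → used3 G π k ≡ true → k ∈ tabulate (used3 G π)
    to {G} {k} q = lookup⇒[]= k _ (trans (lookup∘tabulate (used3 G π) k) q)
    from : ∀ {G k} → k ∈ tabulate (used3 G π) → used3 G π k ≡ true
    from {G} {k} k∈ = trans (sym (lookup∘tabulate (used3 G π) k)) ([]=⇒lookup k∈)
    unused-false : ∀ {G k} → π k ≡ nothing → used3 G π k ≢ true
    unused-false {k = k} q with π k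
    ... | nothing = λ ()
    E-used : used3 H π E ≡ true
    E-used with π E in eq
    ... | nothing = ⊥-elim (link-used link eq)
    ... | just _ = true-does (_ ℕₚ.≟ 3) (se leafᵤ)
    E-unused : used3 H′ π E ≢ true
    E-unused q with π E
    ... | just _ with () ← trans (sym (trans (cong ∣_∣ at-E) ∣p∣)) (does-true (_ ℕₚ.≟ 3) q)
    transport : ∀ k → lookup H′ k ≡ lookup H k → used3 H′ π k ≡ true → used3 H π k ≡ true
    transport k e q with π k
    ... | just _ = subst (λ s → ⌊ ∣ s ∣ ℕₚ.≟ 3 ⌋ ≡ true) e q
    keep : ∀ k → used3 H′ π k ≡ true → used3 H π k ≡ true
    keep k q with k ≟ E | k ≟ A | k ≟ B
    ... | yes refl | _ | _ = E-used
    ... | no _ | yes refl | _ = ⊥-elim (unused-false {H′} A-unused q)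
    ... | no _ | no _ | yes refl = ⊥-elim (unused-false {H′} B-unused q)
    ... | no k≢E | no k≢A | no k≢B = transport k (elsewhere k≢A k≢B k≢E) q

  three′ : AtMost3 H′
  three′ = three-of is3′

  -- On a class containing u and c, the hyperedge ud takes over the role of ucd.
  closed-switch : ∀ {P l} → Closed H′ (Every H′) π P l → Closed H (Every H) π P l
  closed-switch {P} {l} K {f} {x} {y} _ x∈ y∈ xy fr with f ≟ A | f ≟ B | f ≟ E
  ... | yes refl | _ | _ = K {A} tt (A⊆A′ x∈) (A⊆A′ y∈) xy fr
  ... | no _ | yes refl | _ = K {A} tt (B⊆A′ x∈) (B⊆A′ y∈) xy (inj₁ A-unused)
  ... | no f≢A | no f≢B | no f≢E = K {f} tt (subst (_ ∈_) (sym (elsewhere f≢A f≢B f≢E)) x∈)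
    (subst (_ ∈_) (sym (elsewhere f≢A f≢B f≢E)) y∈) xy fr
  ... | no _ | no _ | yes refl with fr
  ...   | inj₁ r = ⊥-elim (link-used link r)
  ...   | inj₂ (s , t , r , sx , tx , ls≡lt) = trans (to-u x∈ (sym ux)) (sym (to-u y∈ (sym (trans ux xy))))
    where
    ux : P u ≡ P x
    ux with link-ends link (fwd r)
    ... | inj₁ (refl , _) = sx
    ... | inj₂ (refl , _) = tx
    to-u : ∀ {z} → z ∈ lookup H E → P z ≡ P u → l z ≡ l u
    to-u z∈ e with E-cover z∈
    ... | inj₁ refl        = refl
    ... | inj₂ (inj₁ refl) = sym (link-monochrome l (fwd r) link ls≡lt)
    ... | inj₂ (inj₂ refl) = K {B} tt d∈B′ u∈B′ e (inj₁ B-unused)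

  anti-switch : ∀ {P} → Anti H (Every H) π P → Anti H′ (Every H′) π P
  anti-switch a K = a (closed-switch K)

  -- Moves along `ua` or `ub` now follow `uab`. If `ucd` is idle, `u` and `c` share a class of `P`,
  -- so a move along it needs at most `ud`, in slot `B`. The omitted hyperedge changes from `g` to
  -- `g′` to cover both `g′ = g` and the passage from `E` to `B`.
  chain-switch : ∀ {P Q g g′ x y} → P ≼ Q → A ≢ g′ → (E ≢ g → B ≢ g′) →
    (∀ {f} → f ≢ A → f ≢ B → f ≢ E → f ≢ g → f ≢ g′) →
    Chain H π P Q g x y → Star (Chain H′ π P Q g′) x y
  chain-switch P≼Q A≢ B≢ o≢ (inj₁ e) = inj₁ e ◅ ε
  chain-switch {P} {Q} {g} {g′} {x} {y} P≼Q A≢ B≢ o≢ (inj₂ (xy , f , f≢g , I , x∈ , y∈)) with f ≟ A | f ≟ B | f ≟ E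
  ... | yes refl | _ | _ = inj₂ (xy , A , A≢ , inj₁ A-unused , A⊆A′ x∈ , A⊆A′ y∈) ◅ ε
  ... | no _ | yes refl | _ = inj₂ (xy , A , A≢ , inj₁ A-unused , B⊆A′ x∈ , B⊆A′ y∈) ◅ ε
  ... | no f≢A | no f≢B | no f≢E = inj₂ (xy , f , o≢ f≢A f≢B f≢E f≢g , I ,
    subst (_ ∈_) (sym (elsewhere f≢A f≢B f≢E)) x∈ , subst (_ ∈_) (sym (elsewhere f≢A f≢B f≢E)) y∈) ◅ ε
  ... | no _ | no _ | yes refl with I
  ...   | inj₁ r = ⊥-elim (link-used link r)
  ...   | inj₂ (s , t , r , st) with x ≟ y
  ...     | yes refl = ε
  ...     | no x≢y = to-u x∈ (sym ux) ◅◅ reverse (chain-sym H′ π) (to-u y∈ (sym (trans ux xy)))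
    where
    uc : P u ≡ P c
    uc = link-monochrome P (fwd r) link st
    ux : Q u ≡ Q x
    ux = class-meet three Q u≢c x≢y (ue leafᵤ) c∈E x∈ y∈ (P≼Q uc) xy
    to-u : ∀ {z} → z ∈ lookup H E → Q z ≡ Q u → Star (Chain H′ π P Q g′) z u
    to-u z∈ e with E-cover z∈
    ... | inj₁ refl        = ε
    ... | inj₂ (inj₁ refl) = inj₁ (sym uc) ◅ ε
    ... | inj₂ (inj₂ refl) = inj₂ (e , B , B≢ f≢g , inj₁ B-unused , d∈B′ , u∈B′) ◅ ε

  witness-switch : ∀ {T g} → Valid H π T → g ≢ A → g ≢ B → g ≢ E → Witness H π T g → Witness H′ π T g
  witness-switch {T} {g} V g≢A g≢B g≢E W = record
    { at = at ; splits = splits ; a∈ = move a∈ ; b∈ = move b∈ ; R-ab = R-ab ; Q-ab = Q-ab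
    ; chain = ⋆-concat (⋆-map (chain-switch (valid-≼ H π (⊑-trans (there here) at) V)
        (≢-sym g≢A) (λ _ → ≢-sym g≢B) (λ _ _ _ ne → ne)) chain) }
    where
    open Witness W
    move : ∀ {x} → x ∈ lookup H g → x ∈ lookup H′ g
    move = subst (_ ∈_) (sym (elsewhere g≢A g≢B g≢E))

  -- If ucd was cut, then ud is an unused hyperedge that can be added in its place.
  witness-ud : ∀ {T} → Valid H π T → top T u ≡ top T c → Witness H π T E →
    Witness H′ π T B × Transversal H′ B (top T)
  witness-ud {T} V uc W = orient (E-cover a∈) (E-cover b∈)
    where
    open Witness W
    T≼Q : top T ≼ Q
    T≼Q = valid-≼ H π at V
    T≼R : top T ≼ top R
    T≼R = valid-≼ H π (⊑-trans (there here) at) V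
    chain′ : Star (Chain H′ π (top T) (top R) B) a b
    chain′ = ⋆-concat (⋆-map (chain-switch T≼R A≢B (λ ne → ⊥-elim (ne refl)) (λ _ f≢B _ _ → f≢B)) chain)
    build : ∀ {s t} → top T u ≡ top T s → t ≡ d → top R s ≡ top R t → Q s ≢ Q t →
      Star (Chain H′ π (top T) (top R) B) s t → Witness H′ π T B × Transversal H′ B (top T)
    build {s} us refl R-st Q-st w = record
      { at = at ; splits = splits ; a∈ = u∈B′ ; b∈ = d∈B′ ; R-ab = trans (T≼R us) R-st ; Q-ab = Q-ud
      ; chain = inj₁ us ◅ w } , transversal
      where
      Q-ud : Q u ≢ Q d
      Q-ud e = Q-st (trans (sym (T≼Q us)) e)
      transversal : Transversal H′ B (top T)
      transversal x∈ y∈ e with B′-cover x∈ | B′-cover y∈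
      ... | inj₁ refl | inj₁ refl = refl
      ... | inj₂ refl | inj₂ refl = refl
      ... | inj₁ refl | inj₂ refl = ⊥-elim (Q-ud (T≼Q e))
      ... | inj₂ refl | inj₁ refl = ⊥-elim (Q-ud (T≼Q (sym e)))
    orient : a ≡ u ⊎ a ≡ c ⊎ a ≡ d → b ≡ u ⊎ b ≡ c ⊎ b ≡ d → Witness H′ π T B × Transversal H′ B (top T)
    orient (inj₁ p) (inj₂ (inj₂ q)) = build (cong (top T) (sym p)) q R-ab Q-ab chain′
    orient (inj₂ (inj₁ p)) (inj₂ (inj₂ q)) = build (trans uc (cong (top T) (sym p))) q R-ab Q-ab chain′
    orient (inj₂ (inj₂ p)) (inj₁ q) =
      build (cong (top T) (sym q)) p (sym R-ab) (≢-sym Q-ab) (reverse (chain-sym H′ π) chain′)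
    orient (inj₂ (inj₂ p)) (inj₂ (inj₁ q)) =
      build (trans uc (cong (top T) (sym q))) p (sym R-ab) (≢-sym Q-ab) (reverse (chain-sym H′ π) chain′)
    orient (inj₁ refl) (inj₁ refl) = ⊥-elim (Q-ab refl)
    orient (inj₁ refl) (inj₂ (inj₁ refl)) = ⊥-elim (Q-ab (T≼Q uc))
    orient (inj₂ (inj₁ refl)) (inj₁ refl) = ⊥-elim (Q-ab (T≼Q (sym uc)))
    orient (inj₂ (inj₁ refl)) (inj₂ (inj₁ refl)) = ⊥-elim (Q-ab refl)
    orient (inj₂ (inj₂ refl)) (inj₂ (inj₂ refl)) = ⊥-elim (Q-ab refl)

  module _ (OK : Hyp n m → Set) (ok′ : OK H′) (ac : Acyc π) where

    valid-switch : ∀ T → Valid H π T → Valid H′ π T ⊎ Better OK T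
    valid-switch whole V = inj₁ tt
    valid-switch (step T k P) (V , P≼T , okₖ) with valid-switch T V
    ... | inj₂ better = inj₂ (better-⊑ (there here) better)
    ... | inj₁ V′ = by-kind k okₖ
      where
      by-kind : ∀ k → StepOK H π T k P → Valid H′ π (step T k P) ⊎ Better OK (step T k P)
      by-kind conn C = inj₁ (V′ , P≼T , C)
      by-kind anti a = inj₁ (V′ , P≼T , anti-switch a)
      by-kind (cutE e) C with e ≟ E
      ... | no e≢E = inj₁ (V′ , P≼T , record
        { pair = pair ; T-uv = T-uv ; P-uv = P-uv ; sides = sides ; connP = connP ; antiT = anti-switch antiT
        ; redund = witness-switch V (λ { refl → just≢nothing pair A-unused })
            (λ { refl → just≢nothing pair B-unused }) e≢E redund })
        where open CutE C
      ... | yes refl with witness-ud V (link-monochrome (top T) (fwd (CutE.pair C)) link (CutE.T-uv C)) (CutE.redund C)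
      ...   | W , t = inj₂ (better-⊑ (there here)
        (Augment.augment H′ three′ OK ok′ (depth T) T ℕₚ.≤-refl wf′ ac V′ B-unused W
          (anti-transversal three′ t (anti-switch (CutE.antiT C)))))
      by-kind (cutH h) C = inj₁ (V′ , P≼T , record
        { unused = CutH.unused C ; transversal = λ x∈ y∈ → transversal (back x∈) (back y∈) ; y∈ = forth y∈ ; w∈ = forth w∈
        ; y≢w = y≢w ; T-yw = T-yw ; antiP = anti-switch antiP ; antiT = anti-switch antiT
        ; redund = witness-switch V h≢A h≢B h≢E redund })
        where
        open CutH C hiding (unused)
        open Witness redund
        -- A pair `h` would consist of `y` and `w`, in one class of `T`, whereas the witness has two
        -- vertices of `h` in different classes.
        not-pair : ∣ lookup H h ∣ ≢ 2
        not-pair two = Q-ab (valid-≼ H π at V (trans (same a∈) (sym (same b∈))))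
          where
          same : ∀ {x} → x ∈ lookup H h → top T x ≡ top T y
          same x∈ with cover₂ (ℕₚ.≤-reflexive two) y≢w y∈ w∈ x∈
          ... | inj₁ refl = refl
          ... | inj₂ refl = sym T-yw
        h≢A : h ≢ A
        h≢A r = not-pair (trans (cong (∣_∣ ∘ lookup H) r) (sa leafᵤ))
        h≢B : h ≢ B
        h≢B r = not-pair (trans (cong (∣_∣ ∘ lookup H) r) (sb leafᵤ))
        h≢E : h ≢ E
        h≢E r = link-used link (trans (cong π (sym r)) (CutH.unused C))
        forth : ∀ {x} → x ∈ lookup H h → x ∈ lookup H′ h
        forth = subst (_ ∈_) (sym (elsewhere h≢A h≢B h≢E))
        back : ∀ {x} → x ∈ lookup H′ h → x ∈ lookup H h
        back = subst (_ ∈_) (elsewhere h≢A h≢B h≢E)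

-- Existence of a skeletal partition without bad leaves

module _ (H₀ : Hyp n m) (R : RootChoice n) where

  OK : Hyp n m → Set
  OK H = Is3Hyp H × Related R H₀ H

  Goal : Set
  Goal = Σ (Hyp n m) λ H~ → Related R H₀ H~ × Is3Hyp H~ ×
    Σ (Quasi n m) λ σ → ValidQ H~ σ × AcyclicQ σ ×
    ((u : Fin n) → ¬ BadLeaf R H~ σ u) ×
    Σ (Fin n → Fin n) λ S → Skeletal H~ σ S

  open Descent OK (λ ok → three-of (proj₁ ok)) #used3 Goal

  finish : Finish
  finish {T} {N} S none with any? (badLeaf? (Stable.wf S) R)
  ... | no no-bad = inj₁ (inj₁ (H , proj₂ ok , proj₁ ok , toQ π , valid-toQ wf , acyclic-toQ acyc ,
    (λ u b → no-bad (u , b)) , top T , skeletal T valid none wf connT antiT))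
    where open Stable S
  ... | yes (u , b) = conclude (valid-switch OK ok′ acyc T valid)
    where
    open Stable S
    open Switch {roots = R} (proj₁ ok) wf b
    ok′ : OK H′
    ok′ = is3′ , (proj₂ ok ◅◅ (toQ π , valid-toQ wf , acyclic-toQ acyc , u , b , p , π-E , refl) ◅ ε)
    conclude : Valid H′ π T ⊎ Better OK T → (Goal ⊎ Better OK T) ⊎ Stable T N
    conclude (inj₂ better) = inj₁ (inj₂ better)
    conclude (inj₁ V′) = inj₂ record
      { state = record { H = H′ ; π = π ; ok = ok′ ; wf = wf′ ; acyc = acyc ; valid = V′ }
      ; connT = connT ; antiT = anti-switch antiT ; bound = ℕₚ.<-≤-trans fewer (ℕₚ.≤-pred bound) }

theorem16 : {n m : ℕ} (H : Hyp n m) → Is3Hyp H → (R : RootChoice n) →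
    Σ (Hyp n m) λ H~ → Related R H H~ × Is3Hyp H~ ×
    Σ (Quasi n m) λ σ → ValidQ H~ σ × AcyclicQ σ ×
    ((u : Fin n) → ¬ BadLeaf R H~ σ u) ×
    Σ (Fin n → Fin n) λ S → Skeletal H~ σ S
theorem16 H is3 R = Descent.solve (OK H R) (λ ok → three-of (proj₁ ok)) #used3 (Goal H R) (finish H R)
  record { H = H ; π = λ _ → nothing ; ok = is3 , ε ; wf = wf-intro λ () ; acyc = λ () ; valid = tt }
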